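{- Let $p$ be an odd prime. Then (a) \[ \sum_{j=1}^{p-1}r_4(j) \left( \sigma^{\ast}(p-j)- 4\sigma^{\ast}\!\left(\tfrac{p-j}{2}\right) \right)= p^2 -1, \] (b) \[ \sum_{j=1}^{p-1}r_8(j) \left( \sigma^{\ast}(p-j)- 4\sigma^{\ast}\!\left(\tfrac{p-j}{2}\right) \right)= p^4 -1. \]
   Context: For $k\in\mathbb{N}$, $r_k(n)=\#\{(x_1,\dots,x_k)\in\mathbb{Z}^k : n=x_1^2+\dots+x_k^2\}$. The function $\sigma^{\ast}$ is defined on $\mathbb{Q}$ by $\sigma^{\ast}(q)=0$ if $q\notin\mathbb{N}=\{1,2,\dots\}$, and $\sigma^{\ast}(q)=\sum_{d\mid q,\ q/d\text{ odd}} d$ for $q\in\mathbb{N}$. -}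

module Defs where

open import Data.Nat as ℕ using (ℕ; zero; suc; _∸_; _≡ᵇ_)
open import Data.Nat.Divisibility using (_∣?_)
open import Data.Nat.DivMod using (_/_; _%_)
open import Data.Integer as ℤ using (ℤ; +_; _-_; _*_; _+_)
open import Data.Rational as ℚ using (ℚ)
open import Data.Bool using (Bool; true; false; if_then_else_; _∧_)
open import Data.List using (List; []; _∷_; map; filter; length; upTo; concatMap; foldr)
open import Data.Vec using (Vec; []; _∷_)
import Data.Vec as Vec
open import Relation.Nullary.Decidable using (⌊_⌋; _×-dec_; T?)
import Data.Integer.Properties as ℤP

sumℤ : List ℤ → ℤ
sumℤ = foldr _+_ (+ 0)

allVecs : ∀ {A : Set} (k : ℕ) → List A → List (Vec A k)
allVecs zero    xs = [] ∷ []
allVecs (suc k) xs = concatMap (λ x → map (x ∷_) (allVecs k xs)) xs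

rangeℤ : ℕ → List ℤ
rangeℤ n = map (λ i → + i - + n) (upTo (suc (2 ℕ.* n)))

sumSq : ∀ {k} → Vec ℤ k → ℤ
sumSq = Vec.foldr _ (λ x acc → x * x + acc) (+ 0)

-- r_k(n) = #{x ∈ ℤ^k : n = x_1² + ... + x_k²}.
-- Any such x has |x_i| ≤ n, so it suffices to enumerate [-n, n]^k.
r : ℕ → ℕ → ℕ
r k n = length (filter (λ v → sumSq v ℤP.≟ + n) (allVecs k (rangeℤ n)))

-- σ*(q) = Σ_{d ∣ q, q/d odd} d  for q ∈ ℕ = {1,2,...}  (and 0 for q = 0).
-- The divisors d of q ≥ 1 lie in {1, ..., q}.
oddQuot : ℕ → ℕ → Bool
oddQuot q zero    = false
oddQuot q (suc i) = ⌊ suc i ∣? q ⌋ ∧ ((q / suc i) % 2 ≡ᵇ 1)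

σ*ℕ : ℕ → ℕ
σ*ℕ q = foldr ℕ._+_ 0 (filter (λ d → T? (oddQuot q d)) (map suc (upTo q)))

σ* : ℚ → ℕ
σ* q with ℚ.denominatorℕ q ≡ᵇ 1 | ℚ.numerator q
... | true  | ℤ.+ (suc m) = σ*ℕ (suc m)
... | _     | _           = 0

diffℚ : ℕ → ℕ → ℚ
diffℚ p j = (+ p ℤ.- + j) ℚ./ 1

halfDiffℚ : ℕ → ℕ → ℚ
halfDiffℚ p j = (+ p ℤ.- + j) ℚ./ 2

S : ℕ → ℕ → ℤ
S k p = sumℤ (map (λ i → let j = suc i in
          + r k j * (+ σ* (diffℚ p j) - + 4 * + σ* (halfDiffℚ p j)))
          (upTo (p ∸ 1)))

{-# OPTIONS --safe #-}
module Submission where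

-- Put θ = Σ q^(x²), so that r_k is the coefficient sequence of θ^k, and D = q d/dq.
-- With σ±(n) = σ*(n) − 4 σ*(n/2) one has D θ = 2 θ σ±, hence D θ^k = 2 k θ^k σ±, and the
-- coefficient of q^p expresses the sum in question by r_k(p).  The values r_4(p) and r_8(p)
-- follow because θ^k is the only series g with g(0) = 1 and θ D g = k g D θ, and this
-- equation can be checked for explicit divisor sums g.
--
-- The equation for D θ and those for k = 4, 8 all say that a sum of w(d, e) P(i, d, e) over
-- the solutions of i² + d e = n, d, e > 0, vanishes unless n is a square.  Such solutions are
-- the indefinite forms d x² + 2 i x y − e y², i.e. the edges of Conway's rivers of
-- discriminant 4n; moving along the river permutes them, except where 0 is represented, and
-- permutes the parity classes of (d, e).  So every odd function b(i, d, e) yields a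
-- Liouville-type identity (River.Σ-river), and three polynomials b give what is needed.

open import Defs
open import Data.Bool using (T; if_then_else_; true; false)
open import Data.Empty using (⊥-elim)
open import Data.Integer using (ℤ; +_; -[1+_]; -_; _+_; _-_; _*_; _^_; 0ℤ; 1ℤ; ∣_∣; _⊖_; _<_; +<+)
import Data.Integer.Properties as ℤP
open import Data.Integer.Solver using (module +-*-Solver)
open import Data.Integer.Tactic.RingSolver using (solve-∀)
open import Data.List using (List; []; _∷_; _++_; map; filter; foldr; length; upTo; concatMap; cartesianProduct)
import Data.List.Properties as LP
open import Data.List.Membership.Propositional using (_∈_)
open import Data.List.Membership.Propositional.Properties using (∈-map⁺; ∈-map⁻; ∈-filter⁺; ∈-filter⁻; ∈-upTo⁺; ∈-upTo⁻; ∈-cartesianProduct⁺)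
open import Data.List.Membership.Propositional.Properties.WithK using (unique∧set⇒bag)
open import Data.List.Relation.Binary.BagAndSetEquality using (∼bag⇒↭)
open import Data.List.Relation.Binary.Permutation.Propositional using (_↭_; prep; swap) renaming (refl to ↭refl; trans to ↭trans)
open import Data.List.Relation.Unary.All using ([]; _∷_)
open import Data.List.Relation.Unary.AllPairs using ([]; _∷_)
open import Data.List.Relation.Unary.Any using (here; there)
open import Data.List.Relation.Unary.Unique.Propositional using (Unique)
import Data.List.Relation.Unary.Unique.Propositional.Properties as Uniq
open import Data.Nat as ℕ using (ℕ; zero; suc; parity; z≤n; s≤s; _≡ᵇ_; ⌊_/2⌋)
open import Data.Nat.Coprimality using (Coprime)
import Data.Nat.Coprimality as Coprime
open import Data.Nat.DivMod using (_/_; _%_; m*n/n≡m; m*[n/m]≡n)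
open import Data.Nat.Divisibility using (_∣_; _∣?_; divides; ∣-refl; ∣-antisym; ∣⇒≤)
open import Data.Nat.GCD using (gcd; gcd[m,n]∣n; gcd-greatest)
open import Data.Nat.Induction using (<-rec)
open import Data.Nat.Primality using (Prime; prime⇒irreducible; prime⇒nonTrivial; prime⇒nonZero; prime[2])
import Data.Nat.Properties as ℕP
open import Data.Parity.Base as ℙ using (Parity; 0ℙ; 1ℙ)
import Data.Parity.Properties as ℙP
open import Data.Product using (_×_; _,_; proj₁; proj₂)
open import Data.Rational as ℚ using (mkℚ; ↥_; ↧_)
import Data.Rational.Properties as ℚP
open import Data.Sum using (inj₁; inj₂)
open import Data.Unit using (tt)
open import Data.Vec using (Vec; []; _∷_)
open import Function using (_∘_)
open import Function.Bundles using (mk⇔)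
open import Relation.Binary.Definitions using (tri<; tri≈; tri>)
open import Relation.Binary.PropositionalEquality using (_≡_; _≢_; refl; sym; trans; cong; cong₂; subst; module ≡-Reasoning)
open import Relation.Nullary using (Dec; yes; no; ¬_; does)
open import Relation.Nullary.Decidable using (_×-dec_; ¬?; map′; T?)
open import Relation.Unary using (Decidable; Pred)
import Algebra.Properties.AbelianGroup ℤP.+-0-abelianGroup as ℤG
open +-*-Solver using (Polynomial; con; _:+_; _:*_; _:-_; :-_; _:=_) renaming (solve to solveℤ)

-- The increment of a function over one step along the river would be piecewise, since the step is L
-- or R according to the sign of `above`, and no polynomial identity sees that sign. Parity removes
-- this obstacle: L and R act differently on the three classes of `(d, e)` with an odd entry, and
-- the values on the classes can be matched so that both steps give the same polynomial in the old
-- triple. One polynomial `b` remains free, and its oddness makes the increment symmetric in d and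
-- e. Forms vanishing at (1, 1) have no successor, those vanishing at (1, -1) no predecessor. They
-- force n = s², and those with odd d correspond to the odd numbers below 2s, so the defect is a sum
-- over these numbers. To match `n * θ n` it has to be a multiple of s². The increment needs to
-- agree with the desired summand only after averaging over the sign of i and, when d and e are both
-- odd, over their exchange. Finding `b` is therefore linear algebra.

private
  variable
    A B : Set

-- Finite sums

Σ[_]_ : List A → (A → ℤ) → ℤ
Σ[ xs ] f = sumℤ (map f xs)

infix 5 Σ[_]_

+-congˡ : ∀ a {b c} → b ≡ c → a + b ≡ a + c
+-congˡ a = cong (λ z → a + z)

Σ-cong : ∀ (xs : List A) {f g : A → ℤ} → (∀ {x} → x ∈ xs → f x ≡ g x) → Σ[ xs ] f ≡ Σ[ xs ] g
Σ-cong []       h = refl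
Σ-cong (x ∷ xs) h = cong₂ _+_ (h (here refl)) (Σ-cong xs (h ∘ there))

+-interchange : ∀ a b c d → (a + b) + (c + d) ≡ (a + c) + (b + d)
+-interchange = solve-∀

Σ-+ : ∀ (xs : List A) (f g : A → ℤ) → Σ[ xs ] (λ x → f x + g x) ≡ (Σ[ xs ] f) + (Σ[ xs ] g)
Σ-+ []       f g = refl
Σ-+ (x ∷ xs) f g = trans (+-congˡ (f x + g x) (Σ-+ xs f g)) (+-interchange (f x) (g x) (Σ[ xs ] f) (Σ[ xs ] g))

Σ-*ˡ : ∀ (xs : List A) c (f : A → ℤ) → Σ[ xs ] (λ x → c * f x) ≡ c * (Σ[ xs ] f)
Σ-*ˡ []       c f = sym (ℤP.*-zeroʳ c)
Σ-*ˡ (x ∷ xs) c f = trans (+-congˡ (c * f x) (Σ-*ˡ xs c f)) (sym (ℤP.*-distribˡ-+ c (f x) (Σ[ xs ] f)))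

Σ-0 : ∀ (xs : List A) → Σ[ xs ] (λ _ → 0ℤ) ≡ 0ℤ
Σ-0 []       = refl
Σ-0 (x ∷ xs) = trans (ℤP.+-identityˡ _) (Σ-0 xs)

Σ-++ : ∀ (xs ys : List A) (f : A → ℤ) → Σ[ xs ++ ys ] f ≡ (Σ[ xs ] f) + (Σ[ ys ] f)
Σ-++ []       ys f = sym (ℤP.+-identityˡ _)
Σ-++ (x ∷ xs) ys f = trans (+-congˡ (f x) (Σ-++ xs ys f)) (sym (ℤP.+-assoc (f x) _ _))

Σ-map : ∀ (h : A → B) xs (f : B → ℤ) → Σ[ map h xs ] f ≡ Σ[ xs ] (f ∘ h)
Σ-map h xs f = cong sumℤ (sym (LP.map-∘ xs))

Σ-concatMap : ∀ (h : A → List B) xs (f : B → ℤ) → Σ[ concatMap h xs ] f ≡ Σ[ xs ] (λ x → Σ[ h x ] f)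
Σ-concatMap h []       f = refl
Σ-concatMap h (x ∷ xs) f =
  trans (Σ-++ (h x) (concatMap h xs) f) (+-congˡ (Σ[ h x ] f) (Σ-concatMap h xs f))

Σ-cartesianProduct : ∀ (xs : List A) (ys : List B) f →
  Σ[ cartesianProduct xs ys ] f ≡ Σ[ xs ] (λ x → Σ[ ys ] (λ y → f (x , y)))
Σ-cartesianProduct []       ys f = refl
Σ-cartesianProduct (x ∷ xs) ys f = trans (Σ-++ (map (x ,_) ys) _ f)
  (cong₂ _+_ (Σ-map (x ,_) ys f) (Σ-cartesianProduct xs ys f))

[_]·_ : {P : Set} → Dec P → ℤ → ℤ
[ p ]· z = if does p then z else 0ℤ

infix 9 [_]·_

[]·-yes : {P : Set} (d : Dec P) {z : ℤ} → P → [ d ]· z ≡ z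
[]·-yes (yes _) p = refl
[]·-yes (no ¬p) p = ⊥-elim (¬p p)

[]·-no : {P : Set} (d : Dec P) {z : ℤ} → ¬ P → [ d ]· z ≡ 0ℤ
[]·-no (yes p) ¬p = ⊥-elim (¬p p)
[]·-no (no _)  ¬p = refl

Σ-filter : ∀ {P : Pred A _} (P? : Decidable P) xs (f : A → ℤ) →
  Σ[ filter P? xs ] f ≡ Σ[ xs ] (λ x → [ P? x ]· f x)
Σ-filter P? []       f = refl
Σ-filter P? (x ∷ xs) f with does (P? x)
... | true  = +-congˡ (f x) (Σ-filter P? xs f)
... | false = trans (Σ-filter P? xs f) (sym (ℤP.+-identityˡ _))

length-filter : ∀ {P : Pred A _} (P? : Decidable P) xs →
  + length (filter P? xs) ≡ Σ[ xs ] (λ x → [ P? x ]· 1ℤ)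
length-filter P? xs = trans (length-Σ (filter P? xs)) (Σ-filter P? xs _)
  where
  length-Σ : (ys : List A) → + length ys ≡ Σ[ ys ] (λ _ → 1ℤ)
  length-Σ []       = refl
  length-Σ (y ∷ ys) = +-congˡ 1ℤ (length-Σ ys)

Σ-↭ : ∀ {xs ys : List A} (f : A → ℤ) → xs ↭ ys → Σ[ xs ] f ≡ Σ[ ys ] f
Σ-↭ f ↭refl         = refl
Σ-↭ f (prep x p)   = +-congˡ (f x) (Σ-↭ f p)
Σ-↭ f (swap x y p) = trans (cong (λ z → f x + (f y + z)) (Σ-↭ f p)) (comm (f x) (f y) _)
  where
  comm : ∀ a b c → a + (b + c) ≡ b + (a + c)
  comm = solve-∀
Σ-↭ f (↭trans p q)  = trans (Σ-↭ f p) (Σ-↭ f q)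

-- T and U need to be inverse only on members. `map T xs` has no duplicates because `map U` takes it
-- back to `xs`, and two duplicate-free lists with the same members are permutations of each other.
Σ-bij : ∀ {xs : List A} {ys : List B} {f g} → Unique xs → Unique ys → (T : A → B) (U : B → A) →
  (∀ {x} → x ∈ xs → T x ∈ ys × U (T x) ≡ x × f x ≡ g (T x)) →
  (∀ {y} → y ∈ ys → U y ∈ xs × T (U y) ≡ y) →
  Σ[ xs ] f ≡ Σ[ ys ] g
Σ-bij {A} {B} {xs} {ys} {f} {g} ux uy T U hT hU = begin
  Σ[ xs ] f       ≡⟨ Σ-cong xs (proj₂ ∘ proj₂ ∘ hT) ⟩
  Σ[ xs ] (g ∘ T) ≡⟨ Σ-map T xs g ⟨
  Σ[ map T xs ] g ≡⟨ Σ-↭ g (∼bag⇒↭ (unique∧set⇒bag uTx uy (mk⇔ to from))) ⟩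
  Σ[ ys ] g       ∎
  where
  open ≡-Reasoning
  map-cancel : ∀ zs → (∀ {x} → x ∈ zs → U (T x) ≡ x) → map U (map T zs) ≡ zs
  map-cancel []       h = refl
  map-cancel (z ∷ zs) h = cong₂ _∷_ (h (here refl)) (map-cancel zs (h ∘ there))
  uTx : Unique (map T xs)
  uTx = Uniq.map⁻ (subst Unique (sym (map-cancel xs (proj₁ ∘ proj₂ ∘ hT))) ux)
  to : ∀ {y} → y ∈ map T xs → y ∈ ys
  to m with _ , x∈ , refl ← ∈-map⁻ T m = proj₁ (hT x∈)
  from : ∀ {y} → y ∈ ys → y ∈ map T xs
  from y∈ = subst (_∈ map T xs) (proj₂ (hU y∈)) (∈-map⁺ T (proj₁ (hU y∈)))

Σ-upTo-suc : ∀ n (f : ℕ → ℤ) → Σ[ upTo (suc n) ] f ≡ (Σ[ upTo n ] f) + f n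
Σ-upTo-suc n f = begin
  Σ[ upTo (suc n) ] f               ≡⟨ cong (λ l → Σ[ l ] f) (sym (LP.upTo-∷ʳ n)) ⟩
  Σ[ upTo n ++ n ∷ [] ] f           ≡⟨ Σ-++ (upTo n) _ f ⟩
  (Σ[ upTo n ] f) + (f n + 0ℤ)      ≡⟨ +-congˡ (Σ[ upTo n ] f) (ℤP.+-identityʳ (f n)) ⟩
  (Σ[ upTo n ] f) + f n             ∎
  where open ≡-Reasoning

-- Sums over antidiagonals

diag : (ℕ → ℕ → ℤ) → ℕ → ℤ
diag K zero    = K 0 0
diag K (suc n) = K 0 (suc n) + diag (λ i j → K (suc i) j) n

diag-cong : ∀ n {K L : ℕ → ℕ → ℤ} → (∀ i j → i ℕ.+ j ≡ n → K i j ≡ L i j) → diag K n ≡ diag L n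
diag-cong zero    h = h 0 0 refl
diag-cong (suc n) h = cong₂ _+_ (h 0 (suc n) refl) (diag-cong n (λ i j e → h (suc i) j (cong suc e)))

diag-+ : ∀ n (K L : ℕ → ℕ → ℤ) → diag (λ i j → K i j + L i j) n ≡ diag K n + diag L n
diag-+ zero    K L = refl
diag-+ (suc n) K L =
    trans (+-congˡ (K 0 (suc n) + L 0 (suc n)) (diag-+ n _ _)) (+-interchange (K 0 (suc n)) (L 0 (suc n)) _ _)

diag-*ˡ : ∀ n c (K : ℕ → ℕ → ℤ) → diag (λ i j → c * K i j) n ≡ c * diag K n
diag-*ˡ zero    c K = refl
diag-*ˡ (suc n) c K = trans (+-congˡ (c * K 0 (suc n)) (diag-*ˡ n c _)) (sym (ℤP.*-distribˡ-+ c (K 0 (suc n)) _))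

diag-0 : ∀ n → diag (λ _ _ → 0ℤ) n ≡ 0ℤ
diag-0 zero    = refl
diag-0 (suc n) = trans (ℤP.+-identityˡ _) (diag-0 n)

diag-last : ∀ n (K : ℕ → ℕ → ℤ) → diag K (suc n) ≡ diag (λ i j → K i (suc j)) n + K (suc n) 0
diag-last zero    K = refl
diag-last (suc n) K =
    trans (+-congˡ (K 0 (suc (suc n))) (diag-last n (λ i → K (suc i))))
    (sym (ℤP.+-assoc (K 0 (suc (suc n))) (diag (λ i j → K (suc i) (suc j)) n) _))

diag-flip : ∀ n (K : ℕ → ℕ → ℤ) → diag K n ≡ diag (λ i j → K j i) n
diag-flip zero    K = refl
diag-flip (suc n) K = begin
  K 0 (suc n) + diag (λ i j → K (suc i) j) n ≡⟨ +-congˡ (K 0 (suc n)) (diag-flip n _) ⟩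
  K 0 (suc n) + diag (λ i j → K (suc j) i) n ≡⟨ ℤP.+-comm (K 0 (suc n)) (diag (λ i j → K (suc j) i) n) ⟩
  diag (λ i j → K (suc j) i) n + K 0 (suc n) ≡⟨ diag-last n (λ i j → K j i) ⟨
  diag (λ i j → K j i) (suc n)               ∎
  where open ≡-Reasoning

diag-assoc : ∀ n (K : ℕ → ℕ → ℕ → ℤ) →
  diag (λ i m → diag (K i) m) n ≡ diag (λ m k → diag (λ i j → K i j k) m) n
diag-assoc zero    K = refl
diag-assoc (suc n) K = begin
  (K 0 0 (suc n) + diag (λ j → K 0 (suc j)) n) + diag (λ i m → diag (K (suc i)) m) n
    ≡⟨ +-congˡ (K 0 0 (suc n) + diag (λ j → K 0 (suc j)) n) (diag-assoc n (λ i → K (suc i))) ⟩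
  (K 0 0 (suc n) + diag (λ j → K 0 (suc j)) n) + diag (λ m k → diag (λ i j → K (suc i) j k) m) n
    ≡⟨ ℤP.+-assoc (K 0 0 (suc n)) _ _ ⟩
  K 0 0 (suc n) + (diag (λ j → K 0 (suc j)) n + diag (λ m k → diag (λ i j → K (suc i) j k) m) n)
    ≡⟨ +-congˡ (K 0 0 (suc n)) (diag-+ n _ _) ⟨
  K 0 0 (suc n) + diag (λ m k → K 0 (suc m) k + diag (λ i j → K (suc i) j k) m) n ∎
  where open ≡-Reasoning

diag-Σ : ∀ n (xs : List A) (K : A → ℕ → ℕ → ℤ) →
  diag (λ i j → Σ[ xs ] (λ x → K x i j)) n ≡ Σ[ xs ] (λ x → diag (K x) n)
diag-Σ n []       K = diag-0 n
diag-Σ n (x ∷ xs) K = trans (diag-+ n (K x) _) (+-congˡ (diag (K x) n) (diag-Σ n xs K))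

diag-upTo : ∀ n (f g : ℕ → ℤ) → diag (λ i j → f i * g j) n ≡ Σ[ upTo (suc n) ] (λ i → f i * g (n ℕ.∸ i))
diag-upTo zero    f g = sym (ℤP.+-identityʳ _)
diag-upTo (suc n) f g = +-congˡ (f 0 * g (suc n)) (trans (diag-upTo n (f ∘ suc) g)
  (trans (sym (Σ-map suc (upTo (suc n)) (λ i → f i * g (suc n ℕ.∸ i))))
      (cong (λ l → Σ[ l ] (λ i → f i * g (suc n ℕ.∸ i))) (LP.map-applyUpTo (λ x → x) suc (suc n)))))

-- Parity of integers

par : ℤ → Parity
par x = parity ∣ x ∣

parity-∸ : ∀ {m n} → m ℕ.≤ n → parity (n ℕ.∸ m) ≡ parity m ℙ.+ parity n
parity-∸ {m} {n} m≤n = begin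
  parity (n ℕ.∸ m)                                ≡⟨ ℙP.+-identityˡ _ ⟨
  0ℙ ℙ.+ parity (n ℕ.∸ m)                         ≡⟨ cong (ℙ._+ parity (n ℕ.∸ m)) (ℙP.p+p≡0ℙ (parity m)) ⟨
  (parity m ℙ.+ parity m) ℙ.+ parity (n ℕ.∸ m)    ≡⟨ ℙP.+-assoc (parity m) _ _ ⟩
  parity m ℙ.+ (parity m ℙ.+ parity (n ℕ.∸ m))    ≡⟨ cong (parity m ℙ.+_) (ℙP.+-homo-+ m (n ℕ.∸ m)) ⟨
  parity m ℙ.+ parity (m ℕ.+ (n ℕ.∸ m))           ≡⟨ cong (λ k → parity m ℙ.+ parity k) (ℕP.m+[n∸m]≡n m≤n) ⟩
  parity m ℙ.+ parity n                           ∎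
  where open ≡-Reasoning

par-⊖ : ∀ m n → par (m ⊖ n) ≡ parity m ℙ.+ parity n
par-⊖ m n with ℕP.≤-total m n
... | inj₁ m≤n = trans (cong parity (ℤP.∣⊖∣-≤ m≤n)) (parity-∸ m≤n)
... | inj₂ n≤m = trans (cong parity (trans (ℤP.∣m⊖n∣≡∣n⊖m∣ m n) (ℤP.∣⊖∣-≤ n≤m)))
  (trans (parity-∸ n≤m) (ℙP.+-comm (parity n) _))

par-+ : ∀ x y → par (x + y) ≡ par x ℙ.+ par y
par-+ (+ m)    (+ n)    = ℙP.+-homo-+ m n
par-+ (+ m)    -[1+ n ] = par-⊖ m (suc n)
par-+ -[1+ m ] (+ n)    = trans (par-⊖ n (suc m)) (ℙP.+-comm (parity n) _)
par-+ -[1+ m ] -[1+ n ] = trans (cong (parity ∘ suc) (sym (ℕP.+-suc m n))) (ℙP.+-homo-+ (suc m) (suc n))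

par-neg : ∀ x → par (- x) ≡ par x
par-neg x = cong parity (ℤP.∣-i∣≡∣i∣ x)

par-double : ∀ x → par (x + x) ≡ 0ℙ
par-double x = trans (par-+ x x) (ℙP.p+p≡0ℙ (par x))

-- Squares and the enumeration of integer intervals

square-abs : ∀ x → x * x ≡ + (∣ x ∣ ℕ.* ∣ x ∣)
square-abs (+ zero)  = refl
square-abs (+ suc m) = refl
square-abs -[1+ m ]  = refl

n≤n*n : ∀ n → n ℕ.≤ n ℕ.* n
n≤n*n zero    = z≤n
n≤n*n (suc n) = ℕP.m≤m*n (suc n) (suc n)

rangeℤ-unique : ∀ n → Unique (rangeℤ n)
rangeℤ-unique n = Uniq.map⁺ (ℤP.+-injective ∘ ℤG.∙-cancelʳ (- + n) _ _) (Uniq.upTo⁺ _)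

∈-rangeℤ : ∀ {n x} → ∣ x ∣ ℕ.≤ n → x ∈ rangeℤ n
∈-rangeℤ {n} {x} ∣x∣≤n =
    subst (_∈ rangeℤ n) (sym (shift x ∣x∣≤n)) (∈-map⁺ (λ i → + i - + n) (∈-upTo⁺ (s≤s (bound x ∣x∣≤n))))
  where
  index : ℤ → ℕ
  index (+ m)    = m ℕ.+ n
  index -[1+ m ] = n ℕ.∸ suc m
  bound : ∀ x → ∣ x ∣ ℕ.≤ n → index x ℕ.≤ 2 ℕ.* n
  bound (+ m)    h = subst (m ℕ.+ n ℕ.≤_) (cong (n ℕ.+_) (sym (ℕP.+-identityʳ n))) (ℕP.+-monoˡ-≤ n h)
  bound -[1+ m ] h = ℕP.≤-trans (ℕP.m∸n≤m n (suc m)) (ℕP.m≤m+n n _)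
  cancel : ∀ a b → a ≡ (a + b) - b
  cancel = solve-∀
  shift : ∀ x → ∣ x ∣ ℕ.≤ n → x ≡ + index x - + n
  shift (+ m)    h = cancel (+ m) (+ n)
  shift -[1+ m ] h = sym (trans (cong (_- + n) (sym (ℤP.⊖-≥ h)))
      (trans (cong (_- + n) (sym (ℤP.m-n≡m⊖n n (suc m)))) (lemma (+ n) (+ suc m))))
    where
    lemma : ∀ a b → (a - b) - a ≡ - b
    lemma = solve-∀

-- Solutions of i² + d e = n

Triple : Set
Triple = ℤ × ℤ × ℤ

record InΩ (n : ℕ) (ω : Triple) : Set where
  constructor inΩ
  i = proj₁ ω
  d = proj₁ (proj₂ ω)
  e = proj₂ (proj₂ ω)
  field
    form : i * i + d * e ≡ + n
    d>0  : 0ℤ < d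
    e>0  : 0ℤ < e

opaque
  InΩ? : ∀ n → Decidable (InΩ n)
  InΩ? n (i , d , e) = map′ (λ (q , d>0 , e>0) → inΩ q d>0 e>0) (λ (inΩ q d>0 e>0) → q , d>0 , e>0)
    ((i * i + d * e ℤP.≟ + n) ×-dec (0ℤ ℤP.<? d) ×-dec (0ℤ ℤP.<? e))

cube : ℕ → List Triple
cube n = cartesianProduct (rangeℤ n) (cartesianProduct (rangeℤ n) (rangeℤ n))

-- Positivity of d and e makes the solution set finite: i² and d e are nonnegative with sum n, so
-- neither exceeds n.
InΩ⇒bounds : ∀ n ω → InΩ n ω → ∣ proj₁ ω ∣ ℕ.≤ n × ∣ proj₁ (proj₂ ω) ∣ ℕ.≤ n × ∣ proj₂ (proj₂ ω) ∣ ℕ.≤ n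
InΩ⇒bounds n (i , + suc d , + suc e) (inΩ q (+<+ _) (+<+ _)) =
    ℕP.≤-trans (ℕP.≤-trans (n≤n*n ∣ i ∣) (ℕP.m≤m+n _ _)) (ℕP.≤-reflexive q′)
  , ℕP.≤-trans (ℕP.≤-trans (ℕP.m≤m*n (suc d) (suc e)) (ℕP.m≤n+m _ _)) (ℕP.≤-reflexive q′)
  , ℕP.≤-trans (ℕP.≤-trans (ℕP.m≤n*m (suc e) (suc d)) (ℕP.m≤n+m _ _)) (ℕP.≤-reflexive q′)
  where
  q′ : ∣ i ∣ ℕ.* ∣ i ∣ ℕ.+ suc d ℕ.* suc e ≡ n
  q′ = ℤP.+-injective (trans (cong (_+ (+ suc d) * (+ suc e)) (sym (square-abs i))) q)

opaque
  Ω : ℕ → List Triple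
  Ω n = filter (InΩ? n) (cube n)

  Ω-def : ∀ n → Ω n ≡ filter (InΩ? n) (cube n)
  Ω-def n = refl

  Ω-unique : ∀ n → Unique (Ω n)
  Ω-unique n = Uniq.filter⁺ (InΩ? n)
      (Uniq.cartesianProduct⁺ (rangeℤ-unique n) (Uniq.cartesianProduct⁺ (rangeℤ-unique n) (rangeℤ-unique n)))

  ∈-Ω⁺ : ∀ {n ω} → InΩ n ω → ω ∈ Ω n
  ∈-Ω⁺ {n} {ω} h with bi , bd , be ← InΩ⇒bounds n ω h =
    ∈-filter⁺ (InΩ? n) (∈-cartesianProduct⁺ (∈-rangeℤ bi) (∈-cartesianProduct⁺ (∈-rangeℤ bd) (∈-rangeℤ be))) h

  ∈-Ω⁻ : ∀ {n ω} → ω ∈ Ω n → InΩ n ω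
  ∈-Ω⁻ {n} h = proj₂ (∈-filter⁻ (InΩ? n) {xs = cube n} h)

-- Splitting sums and involutions

Σ-split : ∀ {P : Pred A _} (P? : Decidable P) (xs : List A) (f : A → ℤ) →
  Σ[ xs ] f ≡ (Σ[ filter P? xs ] f) + (Σ[ filter (¬? ∘ P?) xs ] f)
Σ-split P? xs f = begin
  Σ[ xs ] f                                                        ≡⟨ Σ-cong xs (λ {x} _ → split (P? x) (f x)) ⟩
  Σ[ xs ] (λ x → [ P? x ]· f x + [ ¬? (P? x) ]· f x)               ≡⟨ Σ-+ xs _ _ ⟩
  (Σ[ xs ] (λ x → [ P? x ]· f x)) + (Σ[ xs ] (λ x → [ ¬? (P? x) ]· f x))
    ≡⟨ cong₂ _+_ (sym (Σ-filter P? xs f)) (sym (Σ-filter (¬? ∘ P?) xs f)) ⟩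
  (Σ[ filter P? xs ] f) + (Σ[ filter (¬? ∘ P?) xs ] f)              ∎
  where
  open ≡-Reasoning
  split : {Q : Set} (q : Dec Q) (z : ℤ) → z ≡ [ q ]· z + [ ¬? q ]· z
  split (yes _) z = sym (ℤP.+-identityʳ z)
  split (no _)  z = sym (ℤP.+-identityˡ z)

Σ-involution : ∀ {xs : List A} {f : A → ℤ} → Unique xs → (T : A → A) → (∀ {x} → x ∈ xs → T x ∈ xs) →
    (∀ x → T (T x) ≡ x) →
  Σ[ xs ] f ≡ Σ[ xs ] (f ∘ T)
Σ-involution {f = f} u T hT TT = Σ-bij u u T T (λ {x} m → hT m , TT x , cong f (sym (TT x))) (λ {y} m → hT m , TT y)

-- Steps along the river

ι ρ L R L⁻ R⁻ : Triple → Triple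
ι  (i , d , e) = - i , d , e
ρ  (i , d , e) = i , e , d
L  (i , d , e) = i + d , d , e - (i + i) - d
R  (i , d , e) = i - e , d + (i + i) - e , e
L⁻ (i , d , e) = i - d , d , e + (i + i) - d
R⁻ (i , d , e) = i + e , d - (i + i) - e , e

-- For the form d x² + 2 i x y − e y², above is minus its value at (1, 1) and below minus its
-- value at (1, −1); step passes to the basis (1, 0), (1, 1) or (1, 1), (0, 1).
above below : Triple → ℤ
above (i , d , e) = e - (i + i) - d
below (i , d , e) = e + (i + i) - d

step step⁻ : Triple → Triple
step ω with 0ℤ ℤP.<? above ω
... | yes _ = L ω
-- The case `above ω` = 0 also lands here; R would then leave Ω, its second entry being 0, so
-- `Σ-step` excludes such triples.
... | no _  = R ω
step⁻ ω with 0ℤ ℤP.<? below ω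
... | yes _ = L⁻ ω
... | no _  = R⁻ ω

step-L : ∀ ω → 0ℤ < above ω → step ω ≡ L ω
step-L ω p with 0ℤ ℤP.<? above ω
... | yes _ = refl
... | no ¬p = ⊥-elim (¬p p)

step-R : ∀ ω → ¬ 0ℤ < above ω → step ω ≡ R ω
step-R ω p with 0ℤ ℤP.<? above ω
... | yes q = ⊥-elim (p q)
... | no _  = refl

step⁻-L : ∀ ω → 0ℤ < below ω → step⁻ ω ≡ L⁻ ω
step⁻-L ω p with 0ℤ ℤP.<? below ω
... | yes _ = refl
... | no ¬p = ⊥-elim (¬p p)

step⁻-R : ∀ ω → ¬ 0ℤ < below ω → step⁻ ω ≡ R⁻ ω
step⁻-R ω p with 0ℤ ℤP.<? below ω
... | yes q = ⊥-elim (p q)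
... | no _  = refl

-0< : ∀ {x} → 0ℤ < x → ¬ 0ℤ < - x
-0< {+ zero} (+<+ ())
-0< {+ suc m} _ ()

0<- : ∀ {x} → ¬ 0ℤ < x → x ≢ 0ℤ → 0ℤ < - x
0<- {+ zero}   _ h = ⊥-elim (h refl)
0<- {+ suc m}  h _ = ⊥-elim (h (+<+ (s≤s z≤n)))
0<- { -[1+ m ]} _ _ = +<+ (s≤s z≤n)

>⇒≢0 : ∀ {x} → 0ℤ < x → x ≢ 0ℤ
>⇒≢0 p refl = ℤP.<-irrefl refl p

triple-≡ : ∀ {i d e i′ d′ e′ : ℤ} → i ≡ i′ → d ≡ d′ → e ≡ e′ → _≡_ {A = Triple} (i , d , e) (i′ , d′ , e′)
triple-≡ refl refl refl = refl

L⁻L : ∀ ω → L⁻ (L ω) ≡ ω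
L⁻L (i , d , e) = triple-≡ (p i d) refl (q i d e)
  where
  p : ∀ i d → i + d - d ≡ i
  p = solve-∀
  q : ∀ i d e → (e - (i + i) - d) + ((i + d) + (i + d)) - d ≡ e
  q = solve-∀

LL⁻ : ∀ ω → L (L⁻ ω) ≡ ω
LL⁻ (i , d , e) = triple-≡ (p i d) refl (q i d e)
  where
  p : ∀ i d → i - d + d ≡ i
  p = solve-∀
  q : ∀ i d e → (e + (i + i) - d) - ((i - d) + (i - d)) - d ≡ e
  q = solve-∀

R⁻R : ∀ ω → R⁻ (R ω) ≡ ω
R⁻R (i , d , e) = triple-≡ (p i e) (q i d e) refl
  where
  p : ∀ i d → i - d + d ≡ i
  p = solve-∀
  q : ∀ i d e → (d + (i + i) - e) - ((i - e) + (i - e)) - e ≡ d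
  q = solve-∀

RR⁻ : ∀ ω → R (R⁻ ω) ≡ ω
RR⁻ (i , d , e) = triple-≡ (p i e) (q i d e) refl
  where
  p : ∀ i d → i + d - d ≡ i
  p = solve-∀
  q : ∀ i d e → (d - (i + i) - e) + ((i + e) + (i + e)) - e ≡ d
  q = solve-∀

-- The vector (1, -1) of the new basis is, up to sign, the old basis vector that was dropped. Hence
-- `below` is e > 0 after L and -d < 0 after R: its sign reveals the last step, which makes the step
-- invertible.
below-L : ∀ ω → below (L ω) ≡ proj₂ (proj₂ ω)
below-L (i , d , e) = q i d e
  where
  q : ∀ i d e → (e - (i + i) - d) + ((i + d) + (i + d)) - d ≡ e
  q = solve-∀

below-R : ∀ ω → below (R ω) ≡ - proj₁ (proj₂ ω)
below-R (i , d , e) = q i d e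
  where
  q : ∀ i d e → e + ((i - e) + (i - e)) - (d + (i + i) - e) ≡ - d
  q = solve-∀

above-L⁻ : ∀ ω → above (L⁻ ω) ≡ proj₂ (proj₂ ω)
above-L⁻ (i , d , e) = q i d e
  where
  q : ∀ i d e → (e + (i + i) - d) - ((i - d) + (i - d)) - d ≡ e
  q = solve-∀

above-R⁻ : ∀ ω → above (R⁻ ω) ≡ - proj₁ (proj₂ ω)
above-R⁻ (i , d , e) = q i d e
  where
  q : ∀ i d e → e - ((i + e) + (i + e)) - (d - (i + i) - e) ≡ - d
  q = solve-∀

L-Ω : ∀ {n ω} → InΩ n ω → 0ℤ < above ω → InΩ n (L ω)
L-Ω {ω = i , d , e} (inΩ q d>0 e>0) p = inΩ (trans (h i d e) q) d>0 p
  where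
  h : ∀ i d e → (i + d) * (i + d) + d * (e - (i + i) - d) ≡ i * i + d * e
  h = solve-∀

R-Ω : ∀ {n ω} → InΩ n ω → 0ℤ < - above ω → InΩ n (R ω)
R-Ω {ω = i , d , e} (inΩ q d>0 e>0) p = inΩ (trans (h i d e) q) (subst (0ℤ <_) (k i d e) p) e>0
  where
  h : ∀ i d e → (i - e) * (i - e) + (d + (i + i) - e) * e ≡ i * i + d * e
  h = solve-∀
  k : ∀ i d e → - (e - (i + i) - d) ≡ d + (i + i) - e
  k = solve-∀

L⁻-Ω : ∀ {n ω} → InΩ n ω → 0ℤ < below ω → InΩ n (L⁻ ω)
L⁻-Ω {ω = i , d , e} (inΩ q d>0 e>0) p = inΩ (trans (h i d e) q) d>0 p
  where
  h : ∀ i d e → (i - d) * (i - d) + d * (e + (i + i) - d) ≡ i * i + d * e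
  h = solve-∀

R⁻-Ω : ∀ {n ω} → InΩ n ω → 0ℤ < - below ω → InΩ n (R⁻ ω)
R⁻-Ω {ω = i , d , e} (inΩ q d>0 e>0) p = inΩ (trans (h i d e) q) (subst (0ℤ <_) (k i d e) p) e>0
  where
  h : ∀ i d e → (i + e) * (i + e) + (d - (i + i) - e) * e ≡ i * i + d * e
  h = solve-∀
  k : ∀ i d e → - (e + (i + i) - d) ≡ d - (i + i) - e
  k = solve-∀

above≡0? : Decidable (λ ω → above ω ≡ 0ℤ)
above≡0? ω = above ω ℤP.≟ 0ℤ

below≡0? : Decidable (λ ω → below ω ≡ 0ℤ)
below≡0? ω = below ω ℤP.≟ 0ℤ

Σ-step : ∀ n (F G : Triple → ℤ) →
  (∀ ω → 0ℤ < above ω → G ω ≡ F (L ω)) → (∀ ω → ¬ 0ℤ < above ω → G ω ≡ F (R ω)) →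
  Σ[ filter (¬? ∘ above≡0?) (Ω n) ] G ≡ Σ[ filter (¬? ∘ below≡0?) (Ω n) ] F
Σ-step n F G GL GR = Σ-bij (Uniq.filter⁺ _ (Ω-unique n)) (Uniq.filter⁺ _ (Ω-unique n)) step step⁻ to from
  where
  to : ∀ {ω} → ω ∈ filter (¬? ∘ above≡0?) (Ω n) →
       step ω ∈ filter (¬? ∘ below≡0?) (Ω n) × step⁻ (step ω) ≡ ω × G ω ≡ F (step ω)
  to {ω} m with ∈-filter⁻ (¬? ∘ above≡0?) {xs = Ω n} m
  ... | m′ , a≢0 with ∈-Ω⁻ m′ | 0ℤ ℤP.<? above ω
  ... | h@(inΩ _ _ e>0) | yes a>0 =
      ∈-filter⁺ (¬? ∘ below≡0?) (∈-Ω⁺ (L-Ω h a>0)) (>⇒≢0 b>0)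
    , trans (step⁻-L (L ω) b>0) (L⁻L ω) , GL ω a>0
    where b>0 = subst (0ℤ <_) (sym (below-L ω)) e>0
  ... | h@(inΩ _ d>0 _) | no a≯0 =
      ∈-filter⁺ (¬? ∘ below≡0?) (∈-Ω⁺ (R-Ω h (0<- a≯0 a≢0)))
        (λ b≡0 → >⇒≢0 d>0 (ℤP.neg-injective (trans (sym (below-R ω)) b≡0)))
    , trans (step⁻-R (R ω) (subst (λ z → ¬ 0ℤ < z) (sym (below-R ω)) (-0< d>0))) (R⁻R ω) , GR ω a≯0
  from : ∀ {ω} → ω ∈ filter (¬? ∘ below≡0?) (Ω n) →
       step⁻ ω ∈ filter (¬? ∘ above≡0?) (Ω n) × step (step⁻ ω) ≡ ω
  from {ω} m with ∈-filter⁻ (¬? ∘ below≡0?) {xs = Ω n} m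
  ... | m′ , b≢0 with ∈-Ω⁻ m′ | 0ℤ ℤP.<? below ω
  ... | h@(inΩ _ _ e>0) | yes b>0 =
      ∈-filter⁺ (¬? ∘ above≡0?) (∈-Ω⁺ (L⁻-Ω h b>0)) (>⇒≢0 a>0)
    , trans (step-L (L⁻ ω) a>0) (LL⁻ ω)
    where a>0 = subst (0ℤ <_) (sym (above-L⁻ ω)) e>0
  ... | h@(inΩ _ d>0 _) | no b≯0 =
      ∈-filter⁺ (¬? ∘ above≡0?) (∈-Ω⁺ (R⁻-Ω h (0<- b≯0 b≢0)))
        (λ a≡0 → >⇒≢0 d>0 (ℤP.neg-injective (trans (sym (above-R⁻ ω)) a≡0)))
    , trans (step-R (R⁻ ω) (subst (λ z → ¬ 0ℤ < z) (sym (above-R⁻ ω)) (-0< d>0))) (RR⁻ ω)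

-- Parity classes and symmetries of the solutions

byParity : Parity → Parity → ℤ → ℤ → ℤ → ℤ
byParity 1ℙ 1ℙ oo eo oe = oo
byParity 0ℙ 1ℙ oo eo oe = eo
byParity 1ℙ 0ℙ oo eo oe = oe
byParity 0ℙ 0ℙ oo eo oe = 0ℤ

cong₃ : ∀ (b : ℤ → ℤ → ℤ → ℤ) {x x′ y y′ z z′} → x ≡ x′ → y ≡ y′ → z ≡ z′ → b x y z ≡ b x′ y′ z′
cong₃ b refl refl refl = refl

-- Modulo 2, L replaces e by e + d: it exchanges (odd, odd) with (odd, even) and fixes the other
-- classes. Likewise R, treated next, exchanges (odd, odd) with (even, odd).
byParity-L : ∀ p q {r x y z x′ y′ z′} → r ≡ q ℙ.+ p → x ≡ z′ → y ≡ y′ → z ≡ x′ →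
    byParity p q x y z ≡ byParity p r x′ y′ z′
byParity-L 0ℙ 0ℙ refl _ _ _ = refl
byParity-L 0ℙ 1ℙ refl _ h _ = h
byParity-L 1ℙ 0ℙ refl _ _ h = h
byParity-L 1ℙ 1ℙ refl h _ _ = h

byParity-R : ∀ p q {r x y z x′ y′ z′} → r ≡ p ℙ.+ q → x ≡ y′ → y ≡ x′ → z ≡ z′ →
    byParity p q x y z ≡ byParity r q x′ y′ z′
byParity-R 0ℙ 0ℙ refl _ _ _ = refl
byParity-R 0ℙ 1ℙ refl _ h _ = h
byParity-R 1ℙ 0ℙ refl _ _ h = h
byParity-R 1ℙ 1ℙ refl h _ _ = h

par-+- : ∀ x y → par (x - y) ≡ par x ℙ.+ par y
par-+- x y = trans (par-+ x (- y)) (cong (par x ℙ.+_) (par-neg y))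

par-+2 : ∀ x i → par (x + (i + i)) ≡ par x
par-+2 x i = trans (par-+ x (i + i)) (trans (cong (par x ℙ.+_) (par-double i)) (ℙP.+-identityʳ (par x)))

par--2 : ∀ x i → par (x - (i + i)) ≡ par x
par--2 x i = trans (par-+- x (i + i)) (trans (cong (par x ℙ.+_) (par-double i)) (ℙP.+-identityʳ (par x)))

ι-Ω : ∀ {n ω} → ω ∈ Ω n → ι ω ∈ Ω n
ι-Ω {ω = i , d , e} m with inΩ q d>0 e>0 ← ∈-Ω⁻ m = ∈-Ω⁺ (inΩ (trans (h i d e) q) d>0 e>0)
  where
  h : ∀ i d e → (- i) * (- i) + d * e ≡ i * i + d * e
  h = solve-∀

ρ-Ω : ∀ {n ω} → ω ∈ Ω n → ρ ω ∈ Ω n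
ρ-Ω {ω = i , d , e} m with inΩ q d>0 e>0 ← ∈-Ω⁻ m = ∈-Ω⁺ (inΩ (trans (h i d e) q) e>0 d>0)
  where
  h : ∀ i d e → i * i + e * d ≡ i * i + d * e
  h = solve-∀

ιι : ∀ ω → ι (ι ω) ≡ ω
ιι (i , d , e) = cong (_, d , e) (ℤP.neg-involutive i)

Σ-ι : ∀ n (f : Triple → ℤ) → Σ[ Ω n ] f ≡ Σ[ Ω n ] (f ∘ ι)
Σ-ι n f = Σ-involution (Ω-unique n) ι ι-Ω ιι

Σ-ρ : ∀ n (f : Triple → ℤ) → Σ[ Ω n ] f ≡ Σ[ Ω n ] (f ∘ ρ)
Σ-ρ n f = Σ-involution (Ω-unique n) ρ ρ-Ω (λ _ → refl)

double-injective : ∀ {x y} → x + x ≡ y + y → x ≡ y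
double-injective {x} {y} h = ℤP.*-cancelˡ-≡ (+ 2) x y (trans (two x) (trans h (sym (two y))))
  where
  two : ∀ x → + 2 * x ≡ x + x
  two = solve-∀

-- The forms vanishing at (1, 1), where the river ends.
edge : ℕ → List Triple
edge n = filter above≡0? (Ω n)

above⇒e : ∀ i d e → e - (i + i) - d ≡ 0ℤ → e ≡ d + (i + i)
above⇒e i d e h = trans (k i d e) (trans (cong (_+ (d + (i + i))) h) (ℤP.+-identityˡ _))
  where
  k : ∀ i d e → e ≡ (e - (i + i) - d) + (d + (i + i))
  k = solve-∀

-- The Liouville-type identity of an odd function

module River (b : ℤ → ℤ → ℤ → ℤ) (b-odd : ∀ x y z → b (- x) (- y) (- z) ≡ - b x y z) where

  -- Only b on the class (even, odd) is free: the other two rows of F are forced by the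
  -- requirement that the value G of F after a step be the same for both kinds of step.
  F G K V : Triple → ℤ
  F (i , d , e) = byParity (par d) (par e) (b (d - i) (d - (i + i) - e) (- d)) (b i d e)
      (b (- i - e) (- e) (e + (i + i) - d))
  G (i , d , e) = byParity (par d) (par e) (b (i - e) (d + (i + i) - e) e) (b (i + d) d (e - (i + i) - d))
      (b (- i) (- e) (- d))
  -- K is one half of the increment G - F; the other half is K ∘ ρ, which covers the class (odd,
  -- even).
  K (i , d , e) = byParity (par d) (par e) (b (i - e) (d + (i + i) - e) e) (b (i + d) d (e - (i + i) - d) - b i d e)
      0ℤ
  -- `par d` stands twice because e = d + 2i on `edge`, so that d and e have the same parity there.
  V (i , d , e) = byParity (par d) (par d) (b (- (d + i)) 0ℤ e) 0ℤ 0ℤ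

  GL : ∀ ω → G ω ≡ F (L ω)
  GL (i , d , e) =
    byParity-L (par d) (par e) (trans (par-+- (e - (i + i)) d) (cong (ℙ._+ par d) (par--2 e i)))
        (cong₃ b (h₁ i d e) (h₂ i d e) (h₃ i d e)) refl (cong₃ b (h₄ i d) (h₅ i d e) refl)
    where
    h₁ : ∀ i d e → i - e ≡ - (i + d) - (e - (i + i) - d)
    h₁ = solve-∀
    h₂ : ∀ i d e → d + (i + i) - e ≡ - (e - (i + i) - d)
    h₂ = solve-∀
    h₃ : ∀ i d e → e ≡ (e - (i + i) - d) + ((i + d) + (i + d)) - d
    h₃ = solve-∀
    h₄ : ∀ i d → - i ≡ d - (i + d)
    h₄ = solve-∀
    h₅ : ∀ i d e → - e ≡ d - ((i + d) + (i + d)) - (e - (i + i) - d)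
    h₅ = solve-∀

  GR : ∀ ω → G ω ≡ F (R ω)
  GR (i , d , e) =
    byParity-R (par d) (par e) (trans (par-+- (d + (i + i)) e) (cong (ℙ._+ par e) (par-+2 d i))) refl
        (cong₃ b (h₁ i d e) (h₂ i d e) (h₃ i d e)) (cong₃ b (h₄ i e) refl (h₅ i d e))
    where
    h₁ : ∀ i d e → i + d ≡ (d + (i + i) - e) - (i - e)
    h₁ = solve-∀
    h₂ : ∀ i d e → d ≡ (d + (i + i) - e) - ((i - e) + (i - e)) - e
    h₂ = solve-∀
    h₃ : ∀ i d e → e - (i + i) - d ≡ - (d + (i + i) - e)
    h₃ = solve-∀
    h₄ : ∀ i e → - i ≡ - (i - e) - e
    h₄ = solve-∀
    h₅ : ∀ i d e → - d ≡ e + ((i - e) + (i - e)) - (d + (i + i) - e)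
    h₅ = solve-∀

  -- Oddness of `b` turns the rows of F and G whose last argument is -d or whose second is -e into
  -- negatives of `b` at the exchanged triple: on (odd, odd) F is -K ∘ ρ, and on (odd, even) G - F
  -- is K ∘ ρ.
  G≡F+K : ∀ ω → G ω ≡ F ω + (K ω + K (ρ ω))
  G≡F+K (i , d , e) with par d | par e
  ... | 0ℙ | 0ℙ = refl
  ... | 0ℙ | 1ℙ = h (b (i + d) d (e - (i + i) - d)) (b i d e)
    where
    h : ∀ x y → x ≡ y + ((x - y) + 0ℤ)
    h = solve-∀
  ... | 1ℙ | 0ℙ = trans (b-odd i e d)
      (trans (h (b i e d) (b (i + e) e (d - (i + i) - e)))
        (cong (_+ (0ℤ + (b (i + e) e (d - (i + i) - e) - b i e d)))
          (trans (sym (b-odd (i + e) e (d - (i + i) - e))) (cong₃ b (k₁ i e) refl (k₂ i d e)))))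
    where
    h : ∀ x y → - x ≡ - y + (0ℤ + (y - x))
    h = solve-∀
    k₁ : ∀ i e → - (i + e) ≡ - i - e
    k₁ = solve-∀
    k₂ : ∀ i d e → - (d - (i + i) - e) ≡ e + (i + i) - d
    k₂ = solve-∀
  ... | 1ℙ | 1ℙ = trans (h (b (i - e) (d + (i + i) - e) e) (b (i - d) (e + (i + i) - d) d))
      (cong (_+ (b (i - e) (d + (i + i) - e) e + b (i - d) (e + (i + i) - d) d))
        (trans (sym (b-odd (i - d) (e + (i + i) - d) d)) (cong₃ b (k₁ i d) (k₂ i d e) refl)))
    where
    h : ∀ x y → x ≡ - y + (x + y)
    h = solve-∀
    k₁ : ∀ i d → - (i - d) ≡ d - i
    k₁ = solve-∀
    k₂ : ∀ i d e → - (e + (i + i) - d) ≡ d - (i + i) - e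
    k₂ = solve-∀

  σ : Triple → Triple
  σ (i , d , e) = - i , e , d

  -- In general neither ι nor ρ preserves `edge`; their composite does, because it negates `above`.
  σ-edge : ∀ {n ω} → ω ∈ edge n → σ ω ∈ edge n
  σ-edge {n} {i , d , e} m with m′ , a≡0 ← ∈-filter⁻ above≡0? {xs = Ω n} m =
    ∈-filter⁺ above≡0? (ι-Ω (ρ-Ω m′)) (trans (h i d e) (cong -_ a≡0))
    where
    h : ∀ i d e → d - (- i + - i) - e ≡ - (e - (i + i) - d)
    h = solve-∀

  -- On `edge`, d and e have the same parity. If both are odd, G equals V and, by oddness of `b`, F
  -- ∘ ι equals -V ∘ σ; if both are even, everything vanishes.
  edge-split : ∀ i d e → e - (i + i) - d ≡ 0ℤ →
    G (i , d , e) ≡ F (ι (i , d , e)) + (V (i , d , e) + V (σ (i , d , e)))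
  edge-split i d e h with refl ← above⇒e i d e h rewrite par-+2 d i with par d
  ... | 0ℙ = refl
  ... | 1ℙ = trans
    (k (b (i - (d + (i + i))) (d + (i + i) - (d + (i + i))) (d + (i + i))) (b (- (d + i)) 0ℤ d))
    (cong₂ _+_ (trans (sym (b-odd (- (d + i)) 0ℤ d)) (cong₃ b (k₁ i d) (k₂ i d) refl))
      (cong₂ _+_ (cong₃ b (k₃ i d) (ℤP.+-inverseʳ (d + (i + i))) refl) (cong₃ b (k₄ i d) refl refl)))
    where
    k : ∀ x y → x ≡ - y + (x + y)
    k = solve-∀
    k₁ : ∀ i d → - - (d + i) ≡ d - - i
    k₁ = solve-∀
    k₂ : ∀ i d → 0ℤ ≡ d - (- i + - i) - (d + (i + i))
    k₂ = solve-∀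
    k₃ : ∀ i d → i - (d + (i + i)) ≡ - (d + i)
    k₃ = solve-∀
    k₄ : ∀ i d → - (d + i) ≡ - ((d + (i + i)) + - i)
    k₄ = solve-∀

  Σ-below : ∀ n → Σ[ filter below≡0? (Ω n) ] F ≡ Σ[ edge n ] (F ∘ ι)
  Σ-below n = Σ-bij (Uniq.filter⁺ below≡0? (Ω-unique n)) (Uniq.filter⁺ above≡0? (Ω-unique n)) ι ι
    (λ {ω} m → let m′ , h = ∈-filter⁻ below≡0? {xs = Ω n} m in
      ∈-filter⁺ above≡0? (ι-Ω m′) (trans (to ω) h) , ιι ω , cong F (sym (ιι ω)))
    (λ {ω} m → let m′ , h = ∈-filter⁻ above≡0? {xs = Ω n} m in
      ∈-filter⁺ below≡0? (ι-Ω m′) (trans (from ω) h) , ιι ω)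
    where
    to : ∀ ω → above (ι ω) ≡ below ω
    to (i , d , e) = h i d e
      where
      h : ∀ i d e → e - (- i + - i) - d ≡ e + (i + i) - d
      h = solve-∀
    from : ∀ ω → below (ι ω) ≡ above ω
    from (i , d , e) = h i d e
      where
      h : ∀ i d e → e + (- i + - i) - d ≡ e - (i + i) - d
      h = solve-∀

  -- The difference Σ G - Σ F is computed twice. Pointwise it is Σ K + Σ K ∘ ρ. Along the river only
  -- the ends survive: G where `above` is 0, minus F where `below` is 0, the latter carried to
  -- `edge` by ι. As ρ permutes Ω and σ permutes `edge`, both results are doubles.
  Σ-river : ∀ n → Σ[ Ω n ] K ≡ Σ[ edge n ] V
  Σ-river n = double-injective (ℤG.∙-cancelˡ (Σ[ Ω n ] F) _ _ (ℤG.∙-cancelˡ (Σ[ edge n ] (F ∘ ι)) _ _ (begin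
    sFι + (sF + (sK + sK))         ≡⟨ cong (λ z → sFι + (sF + (sK + z))) (Σ-ρ n K) ⟩
    sFι + (sF + (sK + (Σ[ Ω n ] (K ∘ ρ))))
      ≡⟨ cong (λ z → sFι + (sF + z)) (Σ-+ (Ω n) K (K ∘ ρ)) ⟨
    sFι + (sF + (Σ[ Ω n ] (λ ω → K ω + K (ρ ω))))
      ≡⟨ +-congˡ sFι (Σ-+ (Ω n) F _) ⟨
    sFι + (Σ[ Ω n ] (λ ω → F ω + (K ω + K (ρ ω))))
      ≡⟨ +-congˡ sFι (Σ-cong (Ω n) (λ {ω} _ → G≡F+K ω)) ⟨
    sFι + (Σ[ Ω n ] G)
      ≡⟨ +-congˡ sFι (Σ-split above≡0? (Ω n) G) ⟩
    sFι + ((Σ[ edge n ] G) + (Σ[ filter (¬? ∘ above≡0?) (Ω n) ] G))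
      ≡⟨ cong (λ z → sFι + ((Σ[ edge n ] G) + z)) (Σ-step n F G (λ ω _ → GL ω) (λ ω _ → GR ω)) ⟩
    sFι + ((Σ[ edge n ] G) + rest)
      ≡⟨ cong (λ z → z + ((Σ[ edge n ] G) + rest)) (Σ-below n) ⟨
    sF₋ + ((Σ[ edge n ] G) + rest)
      ≡⟨ shuffle sF₋ (Σ[ edge n ] G) rest ⟩
    (Σ[ edge n ] G) + (sF₋ + rest)
      ≡⟨ +-congˡ (Σ[ edge n ] G) (Σ-split below≡0? (Ω n) F) ⟨
    (Σ[ edge n ] G) + sF
      ≡⟨ cong (λ z → z + sF)
          (Σ-cong (edge n) (λ {ω} m → edge-split _ _ _ (proj₂ (∈-filter⁻ above≡0? {xs = Ω n} m)))) ⟩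
    (Σ[ edge n ] (λ ω → F (ι ω) + (V ω + V (σ ω)))) + sF
      ≡⟨ cong (λ z → z + sF) (Σ-+ (edge n) (F ∘ ι) _) ⟩
    (sFι + (Σ[ edge n ] (λ ω → V ω + V (σ ω)))) + sF
      ≡⟨ cong (λ z → (sFι + z) + sF) (Σ-+ (edge n) V (V ∘ σ)) ⟩
    (sFι + (sV + (Σ[ edge n ] (V ∘ σ)))) + sF
      ≡⟨ cong (λ z → (sFι + (sV + z)) + sF) (Σ-involution (Uniq.filter⁺ above≡0? (Ω-unique n)) σ σ-edge
           (λ (i , d , e) → cong (_, d , e) (ℤP.neg-involutive i))) ⟨
    (sFι + (sV + sV)) + sF
      ≡⟨ reorder sFι (sV + sV) sF ⟩
    sFι + (sF + (sV + sV)) ∎)))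
    where
    open ≡-Reasoning
    sF sFι sF₋ sK sV rest : ℤ
    sF  = Σ[ Ω n ] F
    sFι = Σ[ edge n ] (F ∘ ι)
    sF₋ = Σ[ filter below≡0? (Ω n) ] F
    sK  = Σ[ Ω n ] K
    sV  = Σ[ edge n ] V
    rest = Σ[ filter (¬? ∘ below≡0?) (Ω n) ] F
    shuffle : ∀ x y z → x + (y + z) ≡ y + (x + z)
    shuffle = solve-∀
    reorder : ∀ x y z → (x + y) + z ≡ x + (z + y)
    reorder = solve-∀

-- The end of the river

parity-double : ∀ n → parity (n ℕ.+ n) ≡ 0ℙ
parity-double n = trans (ℙP.+-homo-+ n n) (ℙP.p+p≡0ℙ (parity n))

parity-odd : ∀ j → parity (suc (j ℕ.+ j)) ≡ 1ℙ
parity-odd j = trans (ℙP.+-homo-+ 1 (j ℕ.+ j)) (cong (1ℙ ℙ.+_) (parity-double j))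

even⇒double : ∀ n → parity n ≡ 0ℙ → n ≡ ⌊ n /2⌋ ℕ.+ ⌊ n /2⌋
even⇒double zero          _ = refl
even⇒double (suc (suc n)) h = cong suc (trans (cong suc (even⇒double n h)) (sym (ℕP.+-suc _ _)))

odd⇒suc-double : ∀ n → parity n ≡ 1ℙ → n ≡ suc (⌊ n /2⌋ ℕ.+ ⌊ n /2⌋)
odd⇒suc-double (suc zero)    _ = refl
odd⇒suc-double (suc (suc n)) h = cong suc (trans (cong suc (odd⇒suc-double n h)) (cong suc (sym (ℕP.+-suc _ _))))

half-suc-double : ∀ j → ⌊ suc (j ℕ.+ j) /2⌋ ≡ j
half-suc-double j = sym (ℕP.n≡⌈n+n/2⌉ j)

square-injective : ∀ m n → m ℕ.* m ≡ n ℕ.* n → m ≡ n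
square-injective m n h with ℕP.<-cmp m n
... | tri< m<n _ _ = ⊥-elim (ℕP.<-irrefl h (ℕP.*-mono-< m<n m<n))
... | tri≈ _ e _   = e
... | tri> _ _ n<m = ⊥-elim (ℕP.<-irrefl (sym h) (ℕP.*-mono-< n<m n<m))

0<⇒+ : ∀ {x} → 0ℤ < x → x ≡ + ∣ x ∣
0<⇒+ {+ suc m} _ = refl
0<⇒+ {+ zero} (+<+ ())

0<half : ∀ {x} → 0ℤ < x + x → 0ℤ < x
0<half {+ zero} (+<+ ())
0<half {+ suc m} _ = +<+ (s≤s z≤n)

i<j⇒0<j-i : ∀ {i j} → i < j → 0ℤ < j - i
i<j⇒0<j-i {i} {j} i<j = subst (_< j - i) (ℤP.+-inverseʳ i) (ℤP.+-monoˡ-< (- i) i<j)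

odd-d? : Decidable (λ (ω : Triple) → par (proj₁ (proj₂ ω)) ≡ 1ℙ)
odd-d? ω = par (proj₁ (proj₂ ω)) ℙP.≟ 1ℙ

edge-square : ∀ {n i d e} → (i , d , e) ∈ edge n →
  + n ≡ (d + i) * (d + i) × 0ℤ < d + i × 0ℤ < d × 0ℤ < e × e ≡ d + (i + i)
edge-square {n} {i} {d} {e} m with m′ , a≡0 ← ∈-filter⁻ above≡0? {xs = Ω n} m with inΩ q d>0 e>0 ← ∈-Ω⁻ m′ =
    trans (sym q) (trans (cong (λ z → i * i + d * z) e≡) (h i d))
  -- d + i is positive because its double is d + e.
  , 0<half (subst (0ℤ <_) (trans (cong (λ z → d + z) e≡) (k i d)) (ℤP.+-mono-< d>0 e>0))
  , d>0 , e>0 , e≡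
  where
  e≡ : e ≡ d + (i + i)
  e≡ = above⇒e i d e a≡0
  h : ∀ i d → i * i + d * (d + (i + i)) ≡ (d + i) * (d + i)
  h = solve-∀
  k : ∀ i d → d + (d + (i + i)) ≡ (d + i) + (d + i)
  k = solve-∀

module Edge (b : ℤ → ℤ → ℤ → ℤ) (b-odd : ∀ x y z → b (- x) (- y) (- z) ≡ - b x y z) where
  open River b b-odd

  Σ-edge-nonsquare : ∀ {n} → (∀ s → n ≢ s ℕ.* s) → Σ[ edge n ] V ≡ 0ℤ
  Σ-edge-nonsquare {n} h = trans (Σ-cong (edge n) (λ {ω} m → ⊥-elim (h ∣ proj₁ (proj₂ ω) + proj₁ ω ∣
    (ℤP.+-injective (trans (proj₁ (edge-square m)) (square-abs (proj₁ (proj₂ ω) + proj₁ ω))))))) (Σ-0 (edge n))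

  Σ-edge-odd : ∀ n → Σ[ edge n ] V ≡ Σ[ filter odd-d? (edge n) ] (λ (i , d , e) → b (- (d + i)) 0ℤ e)
  Σ-edge-odd n = begin
    Σ[ edge n ] V ≡⟨ Σ-split odd-d? (edge n) V ⟩
    (Σ[ filter odd-d? (edge n) ] V) + (Σ[ filter (¬? ∘ odd-d?) (edge n) ] V)
      ≡⟨ cong₂ _+_ (Σ-cong (filter odd-d? (edge n)) (λ {ω} m → V-odd ω (proj₂ (∈-filter⁻ odd-d? {xs = edge n} m))))
                   (trans (Σ-cong (filter (¬? ∘ odd-d?) (edge n)) (λ {ω} m →
                       V-even ω (proj₂ (∈-filter⁻ (¬? ∘ odd-d?) {xs = edge n} m))))
                          (Σ-0 (filter (¬? ∘ odd-d?) (edge n)))) ⟩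
    (Σ[ filter odd-d? (edge n) ] V′) + 0ℤ ≡⟨ ℤP.+-identityʳ _ ⟩
    Σ[ filter odd-d? (edge n) ] V′ ∎
    where
    open ≡-Reasoning
    V′ : Triple → ℤ
    V′ (i , d , e) = b (- (d + i)) 0ℤ e
    V-odd : ∀ ω → par (proj₁ (proj₂ ω)) ≡ 1ℙ → V ω ≡ V′ ω
    V-odd (i , d , e) h rewrite h = refl
    V-even : ∀ ω → par (proj₁ (proj₂ ω)) ≢ 1ℙ → V ω ≡ 0ℤ
    V-even (i , d , e) h with par d
    ... | 0ℙ = refl
    ... | 1ℙ = ⊥-elim (h refl)

  -- Here d + i is the positive root s, so e determines i = e - s and d = 2s - e. Positivity of d
  -- means e < 2s, and d is odd exactly when e is, which leaves e = 2j + 1 with j < s.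
  Σ-edge-square : ∀ s → Σ[ edge (s ℕ.* s) ] V ≡ Σ[ upTo s ] (λ j → b (- + s) 0ℤ (+ suc (j ℕ.+ j)))
  Σ-edge-square s = trans (Σ-edge-odd n) (Σ-bij
    (Uniq.filter⁺ odd-d? (Uniq.filter⁺ above≡0? (Ω-unique n))) (Uniq.upTo⁺ s) index point to from)
    where
    n = s ℕ.* s
    index : Triple → ℕ
    index (i , d , e) = ⌊ ∣ e ∣ /2⌋
    point : ℕ → Triple
    point j = + suc (j ℕ.+ j) - + s , (+ s + + s) - + suc (j ℕ.+ j) , + suc (j ℕ.+ j)
    to : ∀ {ω} → ω ∈ filter odd-d? (edge n) →
      index ω ∈ upTo s × point (index ω) ≡ ω × b (- (proj₁ (proj₂ ω) + proj₁ ω)) 0ℤ (proj₂ (proj₂ ω))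
          ≡ b (- + s) 0ℤ (+ suc (index ω ℕ.+ index ω))
    to {i , d , e} m with m′ , d-odd ← ∈-filter⁻ odd-d? {xs = edge n} m
      with q , d+i>0 , d>0 , e>0 , e≡ ← edge-square m′ =
        ∈-upTo⁺ (ℕP.≰⇒> λ s≤k → ℕP.<⇒≱ e<2s (ℕP.≤-trans (ℕP.+-mono-≤ s≤k s≤k) (ℕP.n≤1+n _)))
      , triple-≡ (trans (cong₂ _-_ (sym e≡k) s≡) (h₁ i d e e≡))
          (trans (cong₂ _-_ (cong₂ _+_ s≡ s≡) (sym e≡k)) (h₂ i d e e≡)) (sym e≡k)
      , cong₂ (λ x y → b (- x) 0ℤ y) (sym s≡) e≡k
      where
      k = ⌊ ∣ e ∣ /2⌋
      s≡ : + s ≡ d + i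
      s≡ = trans (cong +_ (square-injective s ∣ d + i ∣ (ℤP.+-injective (trans q (square-abs (d + i))))))
          (sym (0<⇒+ d+i>0))
      par-e : par e ≡ 1ℙ
      par-e = trans (cong par e≡) (trans (par-+2 d i) d-odd)
      e≡k : e ≡ + suc (k ℕ.+ k)
      e≡k = trans (0<⇒+ e>0) (cong +_ (odd⇒suc-double ∣ e ∣ par-e))
      h₁ : ∀ i d e → e ≡ d + (i + i) → e - (d + i) ≡ i
      h₁ i d _ refl = h i d
        where
        h : ∀ i d → d + (i + i) - (d + i) ≡ i
        h = solve-∀
      h₂ : ∀ i d e → e ≡ d + (i + i) → ((d + i) + (d + i)) - e ≡ d
      h₂ i d _ refl = h i d
        where
        h : ∀ i d → ((d + i) + (d + i)) - (d + (i + i)) ≡ d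
        h = solve-∀
      e<2s : suc (k ℕ.+ k) ℕ.< s ℕ.+ s
      e<2s = ℤP.drop‿+<+ (subst (_< + (s ℕ.+ s)) e≡k (subst (e <_) (sym (trans (cong₂ _+_ s≡ s≡) (g i d e e≡)))
        (subst (_< e + d) (ℤP.+-identityʳ e) (ℤP.+-monoʳ-< e d>0))))
        where
        g : ∀ i d e → e ≡ d + (i + i) → (d + i) + (d + i) ≡ e + d
        g i d _ refl = h i d
          where
          h : ∀ i d → (d + i) + (d + i) ≡ d + (i + i) + d
          h = solve-∀
    from : ∀ {j} → j ∈ upTo s → point j ∈ filter odd-d? (edge n) × index (point j) ≡ j
    from {j} m = ∈-filter⁺ odd-d? (∈-filter⁺ above≡0? (∈-Ω⁺ (inΩ
        (trans (h (+ s) (+ suc (j ℕ.+ j))) (sym (ℤP.pos-* s s))) (i<j⇒0<j-i (+<+ 2j+1<2s)) (+<+ (s≤s z≤n))))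
            (k (+ s) (+ suc (j ℕ.+ j))))
        (trans (par-+- (+ s + + s) (+ suc (j ℕ.+ j))) (cong₂ ℙ._+_ (par-double (+ s)) (parity-odd j)))
      , half-suc-double j
      where
      2j+1<2s : suc (j ℕ.+ j) ℕ.< s ℕ.+ s
      2j+1<2s = ℕP.≤-trans (ℕP.≤-reflexive (cong suc (sym (ℕP.+-suc j j)))) (ℕP.+-mono-≤ (∈-upTo⁻ m) (∈-upTo⁻ m))
      h : ∀ s e → (e - s) * (e - s) + ((s + s) - e) * e ≡ s * s
      h = solve-∀
      k : ∀ s e → e - ((e - s) + (e - s)) - ((s + s) - e) ≡ 0ℤ
      k = solve-∀

-- Coefficients of θ and symmetrized summands

θ : ℕ → ℤ
θ n = Σ[ rangeℤ n ] (λ x → [ x * x ℤP.≟ + n ]· 1ℤ)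

θ-nonsquare : ∀ {n} → (∀ s → n ≢ s ℕ.* s) → θ n ≡ 0ℤ
θ-nonsquare {n} h = trans
  (Σ-cong (rangeℤ n) (λ {x} _ →
      []·-no (x * x ℤP.≟ + n) (λ e → h ∣ x ∣ (ℤP.+-injective (trans (sym e) (square-abs x))))))
  (Σ-0 (rangeℤ n))

θ-square : ∀ s → θ (suc s ℕ.* suc s) ≡ + 2
θ-square s = trans (sym (Σ-filter P? (rangeℤ n) (λ _ → 1ℤ))) (Σ-bij {ys = + suc s ∷ -[1+ s ] ∷ []} {g = λ _ → 1ℤ}
  (Uniq.filter⁺ P? (rangeℤ-unique n)) (((λ ()) ∷ []) ∷ [] ∷ []) (λ x → x) (λ x → x)
  (λ {x} m → root x (proj₂ (∈-filter⁻ P? {xs = rangeℤ n} m)) , refl , refl) (λ m → back m , refl))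
  where
  n = suc s ℕ.* suc s
  P? : Decidable (λ x → x * x ≡ + n)
  P? x = x * x ℤP.≟ + n
  root : ∀ x → x * x ≡ + n → x ∈ + suc s ∷ -[1+ s ] ∷ []
  root x h with square-injective ∣ x ∣ (suc s) (ℤP.+-injective (trans (sym (square-abs x)) h))
  root (+ m)    h | refl = here refl
  root -[1+ m ] h | refl = there (here refl)
  back : ∀ {y} → y ∈ + suc s ∷ -[1+ s ] ∷ [] → y ∈ filter P? (rangeℤ n)
  back (here refl)         = ∈-filter⁺ P? (∈-rangeℤ (n≤n*n (suc s))) refl
  back (there (here refl)) = ∈-filter⁺ P? (∈-rangeℤ (n≤n*n (suc s))) refl

-- A summand on Ω matters only through its average over the symmetries that preserve its parity
-- class: ι and ρ on (odd, odd), but only ι on (even, odd), since ρ moves that class to (odd, even).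
Σ-byParity : ∀ n (f g f′ g′ : ℤ → ℤ → ℤ → ℤ) →
  (∀ i d e → (f i d e + f (- i) d e) + (f i e d + f (- i) e d) ≡ (f′ i d e + f′ (- i) d e)
      + (f′ i e d + f′ (- i) e d)) →
  (∀ i d e → g i d e + g (- i) d e ≡ g′ i d e + g′ (- i) d e) →
  Σ[ Ω n ] (λ (i , d , e) → byParity (par d) (par e) (f i d e) (g i d e) 0ℤ) ≡
  Σ[ Ω n ] (λ (i , d , e) → byParity (par d) (par e) (f′ i d e) (g′ i d e) 0ℤ)
Σ-byParity n f g f′ g′ hf hg = trans (split f g) (trans (cong₂ _+_ oo-part eo-part) (sym (split f′ g′)))
  where
  open ≡-Reasoning
  oo eo : (ℤ → ℤ → ℤ → ℤ) → Triple → ℤ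
  oo f (i , d , e) = byParity (par d) (par e) (f i d e) 0ℤ 0ℤ
  eo g (i , d , e) = byParity (par d) (par e) 0ℤ (g i d e) 0ℤ

  split : ∀ f g → Σ[ Ω n ] (λ (i , d , e) → byParity (par d) (par e) (f i d e) (g i d e) 0ℤ) ≡ (Σ[ Ω n ] (oo f))
      + (Σ[ Ω n ] (eo g))
  split f g = trans (Σ-cong (Ω n) (λ {(i , d , e)} _ → pointwise (par d) (par e))) (Σ-+ (Ω n) (oo f) (eo g))
    where
    pointwise : ∀ p q {x y} → byParity p q x y 0ℤ ≡ byParity p q x 0ℤ 0ℤ + byParity p q 0ℤ y 0ℤ
    pointwise 0ℙ 0ℙ = refl
    pointwise 0ℙ 1ℙ = sym (ℤP.+-identityˡ _)
    pointwise 1ℙ 0ℙ = refl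
    pointwise 1ℙ 1ℙ = sym (ℤP.+-identityʳ _)

  by-ι : ∀ h → (Σ[ Ω n ] h) + (Σ[ Ω n ] h) ≡ Σ[ Ω n ] (λ ω → h ω + h (ι ω))
  by-ι h = trans (+-congˡ (Σ[ Ω n ] h) (Σ-ι n h)) (sym (Σ-+ (Ω n) h (h ∘ ι)))
  by-ρ : ∀ h → (Σ[ Ω n ] h) + (Σ[ Ω n ] h) ≡ Σ[ Ω n ] (λ ω → h ω + h (ρ ω))
  by-ρ h = trans (+-congˡ (Σ[ Ω n ] h) (Σ-ρ n h)) (sym (Σ-+ (Ω n) h (h ∘ ρ)))

  eo-part : Σ[ Ω n ] (eo g) ≡ Σ[ Ω n ] (eo g′)
  eo-part = double-injective
      (trans (by-ι (eo g))
      (trans (Σ-cong (Ω n) (λ {(i , d , e)} _ → pointwise (par d) (par e) (hg i d e))) (sym (by-ι (eo g′)))))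
    where
    pointwise : ∀ p q {x y x′ y′} → x + y ≡ x′ + y′ →
        byParity p q 0ℤ x 0ℤ + byParity p q 0ℤ y 0ℤ ≡ byParity p q 0ℤ x′ 0ℤ + byParity p q 0ℤ y′ 0ℤ
    pointwise 0ℙ 0ℙ _ = refl
    pointwise 0ℙ 1ℙ h = h
    pointwise 1ℙ 0ℙ _ = refl
    pointwise 1ℙ 1ℙ _ = refl

  oo-part : Σ[ Ω n ] (oo f) ≡ Σ[ Ω n ] (oo f′)
  oo-part = double-injective
      (double-injective (trans (quad (oo f))
      (trans (Σ-cong (Ω n) (λ {(i , d , e)} _ → pointwise (par d) (par e) (hf i d e))) (sym (quad (oo f′))))))
    where
    quad : ∀ h → ((Σ[ Ω n ] h) + (Σ[ Ω n ] h)) + ((Σ[ Ω n ] h) + (Σ[ Ω n ] h))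
        ≡ Σ[ Ω n ] (λ ω → (h ω + h (ι ω)) + (h (ρ ω) + h (ι (ρ ω))))
    quad h = trans (cong₂ _+_ (by-ι h) (by-ι h)) (by-ρ (λ ω → h ω + h (ι ω)))
    pointwise : ∀ p q {x y z w x′ y′ z′ w′} → (x + y) + (z + w) ≡ (x′ + y′) + (z′ + w′) →
      (byParity p q x 0ℤ 0ℤ + byParity p q y 0ℤ 0ℤ) + (byParity q p z 0ℤ 0ℤ + byParity q p w 0ℤ 0ℤ) ≡
      (byParity p q x′ 0ℤ 0ℤ + byParity p q y′ 0ℤ 0ℤ) + (byParity q p z′ 0ℤ 0ℤ + byParity q p w′ 0ℤ 0ℤ)
    pointwise 0ℙ 0ℙ _ = refl
    pointwise 0ℙ 1ℙ _ = refl
    pointwise 1ℙ 0ℙ _ = refl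
    pointwise 1ℙ 1ℙ h = h

module _ (b : ℤ → ℤ → ℤ → ℤ) (b-odd : ∀ x y z → b (- x) (- y) (- z) ≡ - b x y z) (c : ℤ)
  (boundary : ∀ s → Σ[ upTo s ] (λ j → b (- + s) 0ℤ (+ suc (j ℕ.+ j))) ≡ c * (+ s * + s)) where
  open River b b-odd
  open Edge b b-odd

  -- The factor 2 is the number of roots of n = s² > 0. For nonsquare n both the edge sum and θ n
  -- vanish, and the factor n disposes of θ 0 = 1.
  2Σ-river : ∀ n → + 2 * (Σ[ Ω n ] K) ≡ c * (+ n * θ n)
  2Σ-river n with ℕP.anyUpTo? (λ s → n ℕP.≟ s ℕ.* s) (suc n)
  ... | no none = trans (cong (+ 2 *_) (trans (Σ-river n) (Σ-edge-nonsquare nonsquare)))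
      (sym (trans (cong (λ t → c * (+ n * t)) (θ-nonsquare nonsquare)) (h c (+ n))))
    where
    nonsquare : ∀ s → n ≢ s ℕ.* s
    nonsquare s refl = none (s , s≤s (n≤n*n s) , refl)
    h : ∀ c n → c * (n * 0ℤ) ≡ 0ℤ
    h = solve-∀
  ... | yes (zero  , _ , refl) = trans (cong (+ 2 *_) (trans (Σ-river 0) (Σ-edge-square 0))) (sym (ℤP.*-zeroʳ c))
  ... | yes (suc s , _ , refl) = trans
      (cong (+ 2 *_) (trans (Σ-river n)
          (trans (Σ-edge-square (suc s))
          (trans (boundary (suc s)) (cong (c *_) (sym (ℤP.pos-* (suc s) (suc s))))))))
      (sym (trans (cong (λ t → c * (+ n * t)) (θ-square s)) (h c (+ n))))
    where
    h : ∀ c n → c * (n * + 2) ≡ + 2 * (c * n)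
    h = solve-∀

-- The three instances

telescope : ∀ (f P : ℕ → ℤ) → P 0 ≡ 0ℤ → (∀ m → P (suc m) ≡ P m + f m) → ∀ n → Σ[ upTo n ] f ≡ P n
telescope f P P0 step zero    = sym P0
telescope f P P0 step (suc n) =
    trans (Σ-upTo-suc n f) (trans (cong (λ z → z + f n) (telescope f P P0 step n)) (sym (step n)))

-- Summed over d e = n > 0, w± gives σ*(n) − 4 σ*(n/2), 8 w₄ gives r_4(n), 16 w₈ gives 7 r_8(n).
-- Terms with d odd and e even are moved to (e, d), and those with d and e even are
-- expressed by the others, since the class (even, even) is invariant under step.
w± w₄ w₈ : ℤ → ℤ → ℤ
w± d e = byParity (par d) (par e) d (- d) 0ℤ
w₄ d e = byParity (par d) (par e) d (+ 3 * e) 0ℤ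
w₈ d e = byParity (par d) (par e) (+ 7 * (d * d * d)) (+ 8 * (d * d * d) - + 15 * (e * e * e)) 0ℤ

-- This is the case where `b` is its third argument. Then K is e on (odd, odd), which ρ turns into
-- d, and -2i - d on (even, odd), where ι cancels -2i. The boundary is the sum of the first s odd
-- numbers.
Σ-w± : ∀ n → + 2 * (Σ[ Ω n ] (λ (i , d , e) → w± d e)) ≡ 1ℤ * (+ n * θ n)
Σ-w± n = trans (cong (+ 2 *_)
    (Σ-byParity n (λ i d e → d) (λ i d e → - d) (λ i d e → e) (λ i d e → e - (i + i) - d - e) h₁ h₂))
  (2Σ-river (λ _ _ z → z) (λ _ _ _ → refl) 1ℤ boundary n)
  where
  h₁ : ∀ i d e → (d + d) + (e + e) ≡ (e + e) + (d + d)
  h₁ = solve-∀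
  h₂ : ∀ i d e → - d + - d ≡ (e - (i + i) - d - e) + (e - (- i + - i) - d - e)
  h₂ = solve-∀
  boundary : ∀ s → Σ[ upTo s ] (λ j → + suc (j ℕ.+ j)) ≡ 1ℤ * (+ s * + s)
  boundary s = trans (telescope _ (λ m → + m * + m) refl (λ m → k (+ m)) s) (sym (ℤP.*-identityˡ _))
    where
    k : ∀ m → (1ℤ + m) * (1ℤ + m) ≡ m * m + (1ℤ + (m + m))
    k = solve-∀

*-byParity : ∀ p q c x y → c * byParity p q x y 0ℤ ≡ byParity p q (c * x) (c * y) 0ℤ
*-byParity 0ℙ 0ℙ c x y = ℤP.*-zeroʳ c
*-byParity 0ℙ 1ℙ c x y = refl
*-byParity 1ℙ 0ℙ c x y = ℤP.*-zeroʳ c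
*-byParity 1ℙ 1ℙ c x y = refl

-- b₄ and b₈ are solutions of the linear systems h₁, h₂ below for the coefficients of an
-- odd polynomial of degree 3 resp. 5.
b₄ : ℤ → ℤ → ℤ → ℤ
b₄ i d e = - (+ 2 * (e * e * e)) - d * d * e - + 3 * (i * (e * e))

B₄ : ∀ {n} → Polynomial n → Polynomial n → Polynomial n → Polynomial n
B₄ i d e = :- (con (+ 2) :* (e :* e :* e)) :- d :* d :* e :- con (+ 3) :* (i :* (e :* e))

-- The factor d e - 4 i² is m - 4 j at j = i², m = d e: for the divisor sum g of `w₄`, the sum is
-- the coefficient of qⁿ in θ D g - 4 g D θ.
Σ-w₄ : ∀ n → + 2 * (Σ[ Ω n ] (λ (i , d , e) → (d * e - + 4 * (i * i)) * w₄ d e)) ≡ 1ℤ * (+ n * θ n)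
Σ-w₄ n = trans (cong (+ 2 *_)
    (trans (Σ-cong (Ω n) (λ {(i , d , e)} _ → *-byParity (par d) (par e) (d * e - + 4 * (i * i)) d (+ 3 * e)))
    (Σ-byParity n (λ i d e → (d * e - + 4 * (i * i)) * d) (λ i d e → (d * e - + 4 * (i * i)) * (+ 3 * e))
      (λ i d e → b₄ (i - e) (d + (i + i) - e) e) (λ i d e → b₄ (i + d) d (e - (i + i) - d) - b₄ i d e) h₁ h₂)))
  (2Σ-river b₄ b-odd 1ℤ boundary n)
  where
  T₁ T₂ K₁ K₂ : ∀ {n} → Polynomial n → Polynomial n → Polynomial n → Polynomial n
  T₁ i d e = (d :* e :- con (+ 4) :* (i :* i)) :* d
  T₂ i d e = (d :* e :- con (+ 4) :* (i :* i)) :* (con (+ 3) :* e)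
  K₁ i d e = B₄ (i :- e) (d :+ (i :+ i) :- e) e
  K₂ i d e = B₄ (i :+ d) d (e :- (i :+ i) :- d) :- B₄ i d e
  b-odd : ∀ i d e → b₄ (- i) (- d) (- e) ≡ - b₄ i d e
  b-odd = solveℤ 3 (λ i d e → B₄ (:- i) (:- d) (:- e) := :- B₄ i d e) refl
  h₁ : ∀ i d e → ((d * e - + 4 * (i * i)) * d + (d * e - + 4 * ((- i) * (- i))) * d)
      + ((e * d - + 4 * (i * i)) * e + (e * d - + 4 * ((- i) * (- i))) * e)
    ≡ (b₄ (i - e) (d + (i + i) - e) e + b₄ (- i - e) (d + (- i + - i) - e) e)
        + (b₄ (i - d) (e + (i + i) - d) d + b₄ (- i - d) (e + (- i + - i) - d) d)
  h₁ = solveℤ 3 (λ i d e → (T₁ i d e :+ T₁ (:- i) d e) :+ (T₁ i e d :+ T₁ (:- i) e d) :=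
                           (K₁ i d e :+ K₁ (:- i) d e) :+ (K₁ i e d :+ K₁ (:- i) e d)) refl
  h₂ : ∀ i d e → (d * e - + 4 * (i * i)) * (+ 3 * e) + (d * e - + 4 * ((- i) * (- i))) * (+ 3 * e)
    ≡ (b₄ (i + d) d (e - (i + i) - d) - b₄ i d e) + (b₄ (- i + d) d (e - (- i + - i) - d) - b₄ (- i) d e)
  h₂ = solveℤ 3 (λ i d e → T₂ i d e :+ T₂ (:- i) d e := K₂ i d e :+ K₂ (:- i) d e) refl
  boundary : ∀ s → Σ[ upTo s ] (λ j → b₄ (- + s) 0ℤ (+ suc (j ℕ.+ j))) ≡ 1ℤ * (+ s * + s)
  boundary s = trans (telescope _ (λ m → P (+ s) (+ m)) (h (+ s)) (λ m → k (+ s) (+ m)) s) (l (+ s))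
    where
    -- `b₄` at (-s, 0, e) is 3 s e² - 2 e³. The first m odd numbers have square sum m (4m² - 1) / 3
    -- and cube sum m² (2m² - 1); at m = s the terms in s⁴ cancel.
    P : ℤ → ℤ → ℤ
    P s m = - (+ 2 * (m * m * (+ 2 * (m * m) - 1ℤ))) + s * (m * (+ 4 * (m * m) - 1ℤ))
    P′ : ∀ {n} → Polynomial n → Polynomial n → Polynomial n
    P′ s m = :- (con (+ 2) :* (m :* m :* (con (+ 2) :* (m :* m) :- con 1ℤ)))
      :+ s :* (m :* (con (+ 4) :* (m :* m) :- con 1ℤ))
    h : ∀ s → P s 0ℤ ≡ 0ℤ
    h = solveℤ 1 (λ s → P′ s (con 0ℤ) := con 0ℤ) refl
    k : ∀ s m → P s (1ℤ + m) ≡ P s m + b₄ (- s) 0ℤ (1ℤ + (m + m))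
    k = solveℤ 2 (λ s m → P′ s (con 1ℤ :+ m) := P′ s m :+ B₄ (:- s) (con 0ℤ) (con 1ℤ :+ (m :+ m))) refl
    l : ∀ s → P s s ≡ 1ℤ * (s * s)
    l = solveℤ 1 (λ s → P′ s s := con 1ℤ :* (s :* s)) refl

b₈ : ℤ → ℤ → ℤ → ℤ
b₈ i d e =
  + 12 * (e * e * e * e * e) - + 5 * (d * (e * e * e * e)) + + 12 * (d * d * (e * e * e))
  - + 12 * (d * d * d * (e * e)) + + 45 * (i * (e * e * e * e))
  + + 36 * (i * (d * d) * (e * e)) + + 40 * (i * i * (e * e * e))

B₈ : ∀ {n} → Polynomial n → Polynomial n → Polynomial n → Polynomial n
B₈ i d e =
  con (+ 12) :* (e :* e :* e :* e :* e) :- con (+ 5) :* (d :* (e :* e :* e :* e))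
      :+ con (+ 12) :* (d :* d :* (e :* e :* e))
  :- con (+ 12) :* (d :* d :* d :* (e :* e)) :+ con (+ 45) :* (i :* (e :* e :* e :* e))
  :+ con (+ 36) :* (i :* (d :* d) :* (e :* e)) :+ con (+ 40) :* (i :* i :* (e :* e :* e))

Σ-w₈ : ∀ n → + 2 * (Σ[ Ω n ] (λ (i , d , e) → (d * e - + 8 * (i * i)) * w₈ d e)) ≡ + 7 * (+ n * θ n)
Σ-w₈ n = trans (cong (+ 2 *_)
    (trans (Σ-cong (Ω n) (λ {(i , d , e)} _ →
    *-byParity (par d) (par e) (d * e - + 8 * (i * i)) (+ 7 * (d * d * d))
    (+ 8 * (d * d * d) - + 15 * (e * e * e))))
    (Σ-byParity n (λ i d e → (d * e - + 8 * (i * i)) * (+ 7 * (d * d * d))) (λ i d e →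
        (d * e - + 8 * (i * i)) * (+ 8 * (d * d * d) - + 15 * (e * e * e)))
      (λ i d e → b₈ (i - e) (d + (i + i) - e) e) (λ i d e → b₈ (i + d) d (e - (i + i) - d) - b₈ i d e) h₁ h₂)))
  (2Σ-river b₈ b-odd (+ 7) boundary n)
  where
  T₁ T₂ K₁ K₂ : ∀ {n} → Polynomial n → Polynomial n → Polynomial n → Polynomial n
  T₁ i d e = (d :* e :- con (+ 8) :* (i :* i)) :* (con (+ 7) :* (d :* d :* d))
  T₂ i d e = (d :* e :- con (+ 8) :* (i :* i)) :* (con (+ 8) :* (d :* d :* d) :- con (+ 15) :* (e :* e :* e))
  K₁ i d e = B₈ (i :- e) (d :+ (i :+ i) :- e) e
  K₂ i d e = B₈ (i :+ d) d (e :- (i :+ i) :- d) :- B₈ i d e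
  b-odd : ∀ i d e → b₈ (- i) (- d) (- e) ≡ - b₈ i d e
  b-odd = solveℤ 3 (λ i d e → B₈ (:- i) (:- d) (:- e) := :- B₈ i d e) refl
  h₁ : ∀ i d e → ((d * e - + 8 * (i * i)) * (+ 7 * (d * d * d)) + (d * e - + 8 * ((- i) * (- i)))
      * (+ 7 * (d * d * d)))
      + ((e * d - + 8 * (i * i)) * (+ 7 * (e * e * e)) + (e * d - + 8 * ((- i) * (- i))) * (+ 7 * (e * e * e)))
    ≡ (b₈ (i - e) (d + (i + i) - e) e + b₈ (- i - e) (d + (- i + - i) - e) e)
        + (b₈ (i - d) (e + (i + i) - d) d + b₈ (- i - d) (e + (- i + - i) - d) d)
  h₁ = solveℤ 3 (λ i d e → (T₁ i d e :+ T₁ (:- i) d e) :+ (T₁ i e d :+ T₁ (:- i) e d) :=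
                           (K₁ i d e :+ K₁ (:- i) d e) :+ (K₁ i e d :+ K₁ (:- i) e d)) refl
  h₂ : ∀ i d e → (d * e - + 8 * (i * i)) * (+ 8 * (d * d * d) - + 15 * (e * e * e))
      + (d * e - + 8 * ((- i) * (- i))) * (+ 8 * (d * d * d) - + 15 * (e * e * e))
    ≡ (b₈ (i + d) d (e - (i + i) - d) - b₈ i d e) + (b₈ (- i + d) d (e - (- i + - i) - d) - b₈ (- i) d e)
  h₂ = solveℤ 3 (λ i d e → T₂ i d e :+ T₂ (:- i) d e := K₂ i d e :+ K₂ (:- i) d e) refl
  boundary : ∀ s → Σ[ upTo s ] (λ j → b₈ (- + s) 0ℤ (+ suc (j ℕ.+ j))) ≡ + 7 * (+ s * + s)
  boundary s = trans (telescope _ (λ m → P (+ s) (+ m)) (h (+ s)) (λ m → k (+ s) (+ m)) s) (l (+ s))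
    where
    -- `b₈` at (-s, 0, e) is 12 e⁵ - 45 s e⁴ + 40 s² e³. For the first m odd numbers the sums of
    -- fifth and fourth powers are m² (16m⁴ - 20m² + 7) / 3 and m (48m⁴ - 40m² + 7) / 15; at m = s
    -- the terms in s⁶ and s⁴ cancel.
    P : ℤ → ℤ → ℤ
    P s m = + 4 * (m * m * (+ 16 * (m * m * m * m) - + 20 * (m * m) + + 7)) - + 3
        * (s * m * (+ 48 * (m * m * m * m) - + 40 * (m * m) + + 7)) + + 40
        * (s * s * (m * m * (+ 2 * (m * m) - 1ℤ)))
    P′ : ∀ {n} → Polynomial n → Polynomial n → Polynomial n
    P′ s m = con (+ 4) :* (m :* m :* (con (+ 16) :* (m :* m :* m :* m) :- con (+ 20) :* (m :* m) :+ con (+ 7)))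
        :- con (+ 3) :* (s :* m :* (con (+ 48) :* (m :* m :* m :* m) :- con (+ 40) :* (m :* m) :+ con (+ 7)))
        :+ con (+ 40) :* (s :* s :* (m :* m :* (con (+ 2) :* (m :* m) :- con 1ℤ)))
    h : ∀ s → P s 0ℤ ≡ 0ℤ
    h = solveℤ 1 (λ s → P′ s (con 0ℤ) := con 0ℤ) refl
    k : ∀ s m → P s (1ℤ + m) ≡ P s m + b₈ (- s) 0ℤ (1ℤ + (m + m))
    k = solveℤ 2 (λ s m → P′ s (con 1ℤ :+ m) := P′ s m :+ B₈ (:- s) (con 0ℤ) (con 1ℤ :+ (m :+ m))) refl
    l : ∀ s → P s s ≡ + 7 * (s * s)
    l = solveℤ 1 (λ s → P′ s s := con (+ 7) :* (s :* s)) refl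

-- Divisor sums and powers of θ as coefficient sequences

record InD (n : ℕ) (δ : ℤ × ℤ) : Set where
  constructor inD
  field
    prod : proj₁ δ * proj₂ δ ≡ + n
    d>0  : 0ℤ < proj₁ δ
    e>0  : 0ℤ < proj₂ δ

opaque
  InD? : ∀ n → Decidable (InD n)
  InD? n (d , e) = map′ (λ (q , d>0 , e>0) → inD q d>0 e>0) (λ (inD q d>0 e>0) → q , d>0 , e>0)
    ((d * e ℤP.≟ + n) ×-dec (0ℤ ℤP.<? d) ×-dec (0ℤ ℤP.<? e))

squareℤ : ℕ → List (ℤ × ℤ)
squareℤ n = cartesianProduct (rangeℤ n) (rangeℤ n)

InD⇒bounds : ∀ n δ → InD n δ → ∣ proj₁ δ ∣ ℕ.≤ n × ∣ proj₂ δ ∣ ℕ.≤ n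
InD⇒bounds n (+ suc d , + suc e) (inD q (+<+ _) (+<+ _)) =
    ℕP.≤-trans (ℕP.m≤m*n (suc d) (suc e)) (ℕP.≤-reflexive (ℤP.+-injective q))
  , ℕP.≤-trans (ℕP.m≤n*m (suc e) (suc d)) (ℕP.≤-reflexive (ℤP.+-injective q))

InD⇒∈-squareℤ : ∀ {m n δ} → m ℕ.≤ n → InD m δ → δ ∈ squareℤ n
InD⇒∈-squareℤ {m} {n} {δ} m≤n h with bd , be ← InD⇒bounds m δ h =
  ∈-cartesianProduct⁺ (∈-rangeℤ (ℕP.≤-trans bd m≤n)) (∈-rangeℤ (ℕP.≤-trans be m≤n))

squareℤ-unique : ∀ n → Unique (squareℤ n)
squareℤ-unique n = Uniq.cartesianProduct⁺ (rangeℤ-unique n) (rangeℤ-unique n)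

opaque
  Δ : ℕ → List (ℤ × ℤ)
  Δ n = filter (InD? n) (squareℤ n)

  Δ-def : ∀ n → Δ n ≡ filter (InD? n) (squareℤ n)
  Δ-def n = refl

  Δ-unique : ∀ n → Unique (Δ n)
  Δ-unique n = Uniq.filter⁺ (InD? n) (squareℤ-unique n)

  ∈-Δ⁺ : ∀ {n δ} → InD n δ → δ ∈ Δ n
  ∈-Δ⁺ {n} h = ∈-filter⁺ (InD? n) (InD⇒∈-squareℤ ℕP.≤-refl h) h

  ∈-Δ⁻ : ∀ {n δ} → δ ∈ Δ n → InD n δ
  ∈-Δ⁻ {n} h = proj₂ (∈-filter⁻ (InD? n) {xs = squareℤ n} h)

divisorSum : (ℤ → ℤ → ℤ) → ℕ → ℤ
divisorSum w n = Σ[ Δ n ] (λ (d , e) → w d e)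

-- Coefficients at different indices are enumerated over different ranges. Interchanging their sums
-- with the antidiagonal sum needs one range for all of them.
Σ-extend : ∀ {P : Pred A _} (P? : Decidable P) {xs ys} (f : A → ℤ) → Unique xs → Unique ys →
  (∀ {x} → P x → x ∈ xs) → (∀ {x} → P x → x ∈ ys) →
  Σ[ xs ] (λ x → [ P? x ]· f x) ≡ Σ[ ys ] (λ x → [ P? x ]· f x)
Σ-extend P? {xs} {ys} f ux uy hx hy = trans (sym (Σ-filter P? xs f)) (trans
  (Σ-bij (Uniq.filter⁺ P? ux) (Uniq.filter⁺ P? uy) (λ x → x) (λ x → x)
    (λ m → let h = proj₂ (∈-filter⁻ P? {xs = xs} m) in ∈-filter⁺ P? (hy h) h , refl , refl)
    (λ m → let h = proj₂ (∈-filter⁻ P? {xs = ys} m) in ∈-filter⁺ P? (hx h) h , refl))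
  (Σ-filter P? ys f))

θ-extend : ∀ {n N} → n ℕ.≤ N → θ n ≡ Σ[ rangeℤ N ] (λ x → [ x * x ℤP.≟ + n ]· 1ℤ)
θ-extend {n} {N} n≤N = Σ-extend (λ x → x * x ℤP.≟ + n) (λ _ → 1ℤ) (rangeℤ-unique n) (rangeℤ-unique N)
  (λ {x} h → ∈-rangeℤ (bound x h)) (λ {x} h → ∈-rangeℤ (ℕP.≤-trans (bound x h) n≤N))
  where
  bound : ∀ x → x * x ≡ + n → ∣ x ∣ ℕ.≤ n
  bound x h = ℕP.≤-trans (n≤n*n ∣ x ∣) (ℕP.≤-reflexive (ℤP.+-injective (trans (sym (square-abs x)) h)))

divisorSum-extend : ∀ w {n N} → n ℕ.≤ N →
    divisorSum w n ≡ Σ[ squareℤ N ] (λ δ → [ InD? n δ ]· w (proj₁ δ) (proj₂ δ))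
divisorSum-extend w {n} {N} n≤N =
    trans (cong (λ l → Σ[ l ] (λ (d , e) → w d e)) (Δ-def n)) (trans (Σ-filter (InD? n) (squareℤ n) _)
  (Σ-extend (InD? n) _ (squareℤ-unique n) (squareℤ-unique N) (InD⇒∈-squareℤ ℕP.≤-refl) (InD⇒∈-squareℤ n≤N)))

Σ-*ʳ : ∀ (xs : List A) c (f : A → ℤ) → Σ[ xs ] (λ x → f x * c) ≡ (Σ[ xs ] f) * c
Σ-*ʳ xs c f = trans (Σ-cong xs (λ {x} _ → ℤP.*-comm (f x) c)) (trans (Σ-*ˡ xs c f) (ℤP.*-comm c _))

Σ-product : ∀ (xs : List A) (ys : List B) f g →
    (Σ[ xs ] f) * (Σ[ ys ] g) ≡ Σ[ xs ] (λ x → Σ[ ys ] (λ y → f x * g y))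
Σ-product xs ys f g = trans (sym (Σ-*ʳ xs (Σ[ ys ] g) f)) (Σ-cong xs (λ {x} _ → sym (Σ-*ˡ ys (f x) g)))

diag-point : ∀ n a c (K : ℕ → ℕ → ℤ) → a ℕ.+ c ≡ n → (∀ j m → j ℕ.+ m ≡ n → j ≢ a → K j m ≡ 0ℤ) → diag K n ≡ K a c
diag-point zero    zero    _ K refl h = refl
diag-point (suc n) zero    _ K refl h = trans
  (+-congˡ (K 0 (suc n)) (trans (diag-cong n (λ i j e → h (suc i) j (cong suc e) (λ ()))) (diag-0 n)))
      (ℤP.+-identityʳ _)
diag-point (suc n) (suc a) c K e h = trans (cong₂ _+_ (h 0 (suc n) refl (λ ()))
  (diag-point n a c (λ i j → K (suc i) j) (ℕP.suc-injective e) (λ i j e′ i≢a →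
      h (suc i) j (cong suc e′) (i≢a ∘ ℕP.suc-injective)))) (ℤP.+-identityˡ _)

conv : (ℕ → ℤ) → (ℕ → ℤ) → ℕ → ℤ
conv f g = diag (λ i j → f i * g j)

diag-zero : ∀ n {K : ℕ → ℕ → ℤ} → (∀ i j → i ℕ.+ j ≡ n → K i j ≡ 0ℤ) → diag K n ≡ 0ℤ
diag-zero n h = trans (diag-cong n h) (diag-0 n)

-- A triple fixes the only possible indices j = x² and m = d e, so at most one term of the
-- antidiagonal survives. The weight κ is left open because it is 1 for the product θ σ± and m - k j
-- for the Wronskian.
θ-divisorSum-point : ∀ n (κ : ℤ → ℤ → ℤ) (w : ℤ → ℤ → ℤ) x d e →
  diag (λ j m → κ (+ j) (+ m) * ([ x * x ℤP.≟ + j ]· 1ℤ * [ InD? m (d , e) ]· w d e)) n ≡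
  [ InΩ? n (x , d , e) ]· (κ (x * x) (d * e) * w d e)
θ-divisorSum-point n κ w x d e with InΩ? n (x , d , e)
... | yes (inΩ q d>0 e>0) = trans
    (diag-point n a c K (ℤP.+-injective (trans (cong₂ _+_ (sym a≡) (sym c≡)) q)) off)
    (cong₂ _*_ (cong₂ κ (sym a≡) (sym c≡))
        (trans (cong₂ _*_ ([]·-yes (x * x ℤP.≟ + a) a≡) ([]·-yes (InD? c (d , e)) (inD c≡ d>0 e>0)))
        (ℤP.*-identityˡ _)))
  where
  a = ∣ x ∣ ℕ.* ∣ x ∣
  c = ∣ d ∣ ℕ.* ∣ e ∣
  K : ℕ → ℕ → ℤ
  K j m = κ (+ j) (+ m) * ([ x * x ℤP.≟ + j ]· 1ℤ * [ InD? m (d , e) ]· w d e)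
  a≡ : x * x ≡ + a
  a≡ = square-abs x
  c≡ : d * e ≡ + c
  c≡ = trans (cong₂ _*_ (0<⇒+ d>0) (0<⇒+ e>0)) (sym (ℤP.pos-* ∣ d ∣ ∣ e ∣))
  off : ∀ j m → j ℕ.+ m ≡ n → j ≢ a → K j m ≡ 0ℤ
  off j m _ j≢a = trans (cong (λ z → κ (+ j) (+ m) * (z * [ InD? m (d , e) ]· w d e))
    ([]·-no (x * x ℤP.≟ + j) (λ h → j≢a (ℤP.+-injective (trans (sym h) a≡))))) (ℤP.*-zeroʳ (κ (+ j) (+ m)))
... | no ∉Ω = diag-zero n off
  where
  off : ∀ j m → j ℕ.+ m ≡ n → κ (+ j) (+ m) * ([ x * x ℤP.≟ + j ]· 1ℤ * [ InD? m (d , e) ]· w d e) ≡ 0ℤ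
  off j m j+m≡n with x * x ℤP.≟ + j | InD? m (d , e)
  ... | no _   | _ = ℤP.*-zeroʳ (κ (+ j) (+ m))
  ... | yes _  | no _ = ℤP.*-zeroʳ (κ (+ j) (+ m))
  ... | yes q₁ | yes (inD q₂ d>0 e>0) = ⊥-elim (∉Ω (inΩ (trans (cong₂ _+_ q₁ q₂) (cong +_ j+m≡n)) d>0 e>0))

diag-θ-divisorSum : ∀ n (κ : ℤ → ℤ → ℤ) w → diag (λ j m → κ (+ j) (+ m) * (θ j * divisorSum w m)) n ≡
  Σ[ Ω n ] (λ (i , d , e) → κ (i * i) (d * e) * w d e)
diag-θ-divisorSum n κ w = begin
  diag (λ j m → κ (+ j) (+ m) * (θ j * divisorSum w m)) n
    ≡⟨ diag-cong n (λ j m e → trans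
         (cong (κ (+ j) (+ m) *_)
             (trans (cong₂ _*_ (θ-extend (ℕP.m+n≤o⇒m≤o j (ℕP.≤-reflexive e)))
             (divisorSum-extend w (ℕP.m+n≤o⇒n≤o j (ℕP.≤-reflexive e))))
           (Σ-product (rangeℤ n) (squareℤ n) (λ x → [ x * x ℤP.≟ + j ]· 1ℤ) (λ δ →
               [ InD? m δ ]· w (proj₁ δ) (proj₂ δ)))))
         (trans (sym (Σ-*ˡ (rangeℤ n) (κ (+ j) (+ m)) (λ x →
             Σ[ squareℤ n ] (λ (d , e) → [ x * x ℤP.≟ + j ]· 1ℤ * [ InD? m (d , e) ]· w d e))))
           (Σ-cong (rangeℤ n) (λ {x} _ →
               sym (Σ-*ˡ (squareℤ n) (κ (+ j) (+ m)) (λ (d , e) →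
               [ x * x ℤP.≟ + j ]· 1ℤ * [ InD? m (d , e) ]· w d e)))))) ⟩
  diag (λ j m → Σ[ rangeℤ n ] (λ x → Σ[ squareℤ n ] (λ (d , e) → term x d e j m))) n
    ≡⟨ diag-Σ n (rangeℤ n) (λ x j m → Σ[ squareℤ n ] (λ (d , e) → term x d e j m)) ⟩
  Σ[ rangeℤ n ] (λ x → diag (λ j m → Σ[ squareℤ n ] (λ (d , e) → term x d e j m)) n)
    ≡⟨ Σ-cong (rangeℤ n) (λ {x} _ → diag-Σ n (squareℤ n) (λ (d , e) → term x d e)) ⟩
  Σ[ rangeℤ n ] (λ x → Σ[ squareℤ n ] (λ (d , e) → diag (term x d e) n))
    ≡⟨ Σ-cong (rangeℤ n) (λ {x} _ → Σ-cong (squareℤ n) (λ {(d , e)} _ → θ-divisorSum-point n κ w x d e)) ⟩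
  Σ[ rangeℤ n ] (λ x → Σ[ squareℤ n ] (λ (d , e) → [ InΩ? n (x , d , e) ]· (κ (x * x) (d * e) * w d e)))
    ≡⟨ Σ-cartesianProduct (rangeℤ n) (squareℤ n) (λ (x , d , e) →
        [ InΩ? n (x , d , e) ]· (κ (x * x) (d * e) * w d e)) ⟨
  Σ[ cube n ] (λ (x , d , e) → [ InΩ? n (x , d , e) ]· (κ (x * x) (d * e) * w d e))
    ≡⟨ Σ-filter (InΩ? n) (cube n) (λ (i , d , e) → κ (i * i) (d * e) * w d e) ⟨
  Σ[ filter (InΩ? n) (cube n) ] (λ (i , d , e) → κ (i * i) (d * e) * w d e)
    ≡⟨ cong (λ l → Σ[ l ] (λ (i , d , e) → κ (i * i) (d * e) * w d e)) (Ω-def n) ⟨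
  Σ[ Ω n ] (λ (i , d , e) → κ (i * i) (d * e) * w d e) ∎
  where
  open ≡-Reasoning
  term : ℤ → ℤ → ℤ → ℕ → ℕ → ℤ
  term x d e j m = κ (+ j) (+ m) * ([ x * x ℤP.≟ + j ]· 1ℤ * [ InD? m (d , e) ]· w d e)

-- Powers of θ and representation numbers

one : ℕ → ℤ
one zero    = 1ℤ
one (suc _) = 0ℤ

θ^ : ℕ → ℕ → ℤ
θ^ zero    = one
θ^ (suc k) = conv θ (θ^ k)

sumSq≥0 : ∀ {k} (v : Vec ℤ k) → sumSq v ≡ + ∣ sumSq v ∣
sumSq≥0 []      = refl
sumSq≥0 (x ∷ v) = trans h (cong (λ z → + ∣ z ∣) (sym h))
  where
  h : x * x + sumSq v ≡ + (∣ x ∣ ℕ.* ∣ x ∣ ℕ.+ ∣ sumSq v ∣)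
  h = cong₂ _+_ (square-abs x) (sumSq≥0 v)

θθ-point : ∀ n x {s} → s ≡ + ∣ s ∣ →
    diag (λ j m → [ x * x ℤP.≟ + j ]· 1ℤ * [ s ℤP.≟ + m ]· 1ℤ) n ≡ [ x * x + s ℤP.≟ + n ]· 1ℤ
θθ-point n x {s} s≥0 with x * x + s ℤP.≟ + n
... | yes q = trans
    (diag-point n a c K (ℤP.+-injective (trans (cong₂ _+_ (sym (square-abs x)) (sym s≥0)) q)) off)
    (cong₂ _*_ ([]·-yes (x * x ℤP.≟ + a) (square-abs x)) ([]·-yes (s ℤP.≟ + c) s≥0))
  where
  a = ∣ x ∣ ℕ.* ∣ x ∣
  c = ∣ s ∣
  K : ℕ → ℕ → ℤ
  K j m = [ x * x ℤP.≟ + j ]· 1ℤ * [ s ℤP.≟ + m ]· 1ℤ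
  off : ∀ j m → j ℕ.+ m ≡ n → j ≢ a → K j m ≡ 0ℤ
  off j m _ j≢a = cong (λ z → z * [ s ℤP.≟ + m ]· 1ℤ)
      ([]·-no (x * x ℤP.≟ + j) (λ h → j≢a (ℤP.+-injective (trans (sym h) (square-abs x)))))
... | no ¬q = diag-zero n off
  where
  off : ∀ j m → j ℕ.+ m ≡ n → [ x * x ℤP.≟ + j ]· 1ℤ * [ s ℤP.≟ + m ]· 1ℤ ≡ 0ℤ
  off j m e with x * x ℤP.≟ + j | s ℤP.≟ + m
  ... | no _  | _     = refl
  ... | yes _ | no _  = refl
  ... | yes p | yes q = ⊥-elim (¬q (trans (cong₂ _+_ p q) (cong +_ e)))

-- N is separate from n because in the induction the range of the entries stays fixed while the
-- value left for the remaining squares decreases.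
count-sumSq : ∀ k {n N} → n ℕ.≤ N → Σ[ allVecs k (rangeℤ N) ] (λ v → [ sumSq v ℤP.≟ + n ]· 1ℤ) ≡ θ^ k n
count-sumSq zero    {zero}  _ = refl
count-sumSq zero    {suc n} _ = refl
count-sumSq (suc k) {n} {N} n≤N = sym (begin
  diag (λ j m → θ j * θ^ k m) n
    ≡⟨ diag-cong n (λ j m e → trans (cong₂ _*_ (θ-extend (ℕP.≤-trans (ℕP.m+n≤o⇒m≤o j (ℕP.≤-reflexive e)) n≤N))
         (sym (count-sumSq k (ℕP.≤-trans (ℕP.m+n≤o⇒n≤o j (ℕP.≤-reflexive e)) n≤N))))
             (Σ-product (rangeℤ N) vs (λ x → [ x * x ℤP.≟ + j ]· 1ℤ) (λ v → [ sumSq v ℤP.≟ + m ]· 1ℤ))) ⟩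
  diag (λ j m → Σ[ rangeℤ N ] (λ x → Σ[ vs ] (λ v → term x v j m))) n
    ≡⟨ diag-Σ n (rangeℤ N) (λ x j m → Σ[ vs ] (λ v → term x v j m)) ⟩
  Σ[ rangeℤ N ] (λ x → diag (λ j m → Σ[ vs ] (λ v → term x v j m)) n)
    ≡⟨ Σ-cong (rangeℤ N) (λ {x} _ → trans (diag-Σ n vs (term x)) (Σ-cong vs (λ {v} _ → θθ-point n x (sumSq≥0 v)))) ⟩
  Σ[ rangeℤ N ] (λ x → Σ[ vs ] (λ v → [ x * x + sumSq v ℤP.≟ + n ]· 1ℤ))
    ≡⟨ Σ-cong (rangeℤ N) (λ {x} _ → Σ-map (x ∷_) vs _) ⟨
  Σ[ rangeℤ N ] (λ x → Σ[ map (x ∷_) vs ] (λ v → [ sumSq v ℤP.≟ + n ]· 1ℤ))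
    ≡⟨ Σ-concatMap (λ x → map (x ∷_) vs) (rangeℤ N) _ ⟨
  Σ[ allVecs (suc k) (rangeℤ N) ] (λ v → [ sumSq v ℤP.≟ + n ]· 1ℤ) ∎)
  where
  open ≡-Reasoning
  vs = allVecs k (rangeℤ N)
  term : ℤ → Vec ℤ k → ℕ → ℕ → ℤ
  term x v j m = [ x * x ℤP.≟ + j ]· 1ℤ * [ sumSq v ℤP.≟ + m ]· 1ℤ

r≡θ^ : ∀ k n → + r k n ≡ θ^ k n
r≡θ^ k n = trans (length-filter (λ v → sumSq v ℤP.≟ + n) (allVecs k (rangeℤ n))) (count-sumSq k ℕP.≤-refl)

-- The differential equation of θ^k

conv-congˡ : ∀ n f {g g′ : ℕ → ℤ} → (∀ m → g m ≡ g′ m) → conv f g n ≡ conv f g′ n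
conv-congˡ n f hg = diag-cong n (λ i j _ → cong (f i *_) (hg j))

conv-congʳ : ∀ n g {f f′ : ℕ → ℤ} → (∀ m → f m ≡ f′ m) → conv f g n ≡ conv f′ g n
conv-congʳ n g hf = diag-cong n (λ i j _ → cong (_* g j) (hf i))

conv-comm : ∀ n (f g : ℕ → ℤ) → conv f g n ≡ conv g f n
conv-comm n f g = trans (diag-flip n (λ i j → f i * g j)) (diag-cong n (λ i j _ → ℤP.*-comm (f j) (g i)))

conv-*ˡ : ∀ n c (f g : ℕ → ℤ) → conv (λ i → c * f i) g n ≡ c * conv f g n
conv-*ˡ n c f g = trans (diag-cong n (λ i j _ → ℤP.*-assoc c (f i) (g j))) (diag-*ˡ n c (λ i j → f i * g j))

conv-*ʳ : ∀ n c (f g : ℕ → ℤ) → conv f (λ i → c * g i) n ≡ c * conv f g n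
conv-*ʳ n c f g = trans (diag-cong n (λ i j _ → h (f i) c (g j))) (diag-*ˡ n c (λ i j → f i * g j))
  where
  h : ∀ x c y → x * (c * y) ≡ c * (x * y)
  h = solve-∀

conv-assoc : ∀ n (f g h : ℕ → ℤ) → conv (conv f g) h n ≡ conv f (conv g h) n
conv-assoc n f g h = begin
  diag (λ m k → diag (λ i j → f i * g j) m * h k) n
    ≡⟨ diag-cong n (λ m k _ → trans (ℤP.*-comm _ (h k)) (sym (diag-*ˡ m (h k) (λ i j → f i * g j)))) ⟩
  diag (λ m k → diag (λ i j → h k * (f i * g j)) m) n
    ≡⟨ diag-assoc n (λ i j k → h k * (f i * g j)) ⟨
  diag (λ i m → diag (λ j k → h k * (f i * g j)) m) n
    ≡⟨ diag-cong n (λ i m _ →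
        trans (diag-cong m (λ j k _ → rotate (h k) (f i) (g j))) (diag-*ˡ m (f i) (λ j k → g j * h k))) ⟩
  diag (λ i m → f i * diag (λ j k → g j * h k) m) n ∎
  where
  open ≡-Reasoning
  rotate : ∀ x y z → x * (y * z) ≡ y * (z * x)
  rotate = solve-∀

D : (ℕ → ℤ) → ℕ → ℤ
D f n = + n * f n

D-conv : ∀ n (f g : ℕ → ℤ) → D (conv f g) n ≡ conv (D f) g n + conv f (D g) n
D-conv n f g = begin
  + n * conv f g n
    ≡⟨ diag-*ˡ n (+ n) (λ i j → f i * g j) ⟨
  diag (λ i j → + n * (f i * g j)) n
    ≡⟨ diag-cong n (λ i j e → trans (cong (λ k → + k * (f i * g j)) (sym e)) (h (+ i) (+ j) (f i) (g j))) ⟩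
  diag (λ i j → + i * f i * g j + f i * (+ j * g j)) n
    ≡⟨ diag-+ n (λ i j → + i * f i * g j) (λ i j → f i * (+ j * g j)) ⟩
  conv (D f) g n + conv f (D g) n ∎
  where
  open ≡-Reasoning
  h : ∀ i j x y → (i + j) * (x * y) ≡ i * x * y + x * (j * y)
  h = solve-∀

σ± : ℕ → ℤ
σ± = divisorSum w±

Dθ : ∀ n → D θ n ≡ + 2 * conv θ σ± n
Dθ n = sym (begin
  + 2 * conv θ σ± n
    ≡⟨ cong (+ 2 *_) (diag-cong n (λ i j _ → sym (ℤP.*-identityˡ (θ i * σ± j)))) ⟩
  + 2 * diag (λ i j → 1ℤ * (θ i * σ± j)) n
    ≡⟨ cong (+ 2 *_) (diag-θ-divisorSum n (λ _ _ → 1ℤ) w±) ⟩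
  + 2 * (Σ[ Ω n ] (λ (i , d , e) → 1ℤ * w± d e))
    ≡⟨ cong (+ 2 *_) (Σ-cong (Ω n) (λ {(i , d , e)} _ → ℤP.*-identityˡ (w± d e))) ⟩
  + 2 * (Σ[ Ω n ] (λ (i , d , e) → w± d e))
    ≡⟨ Σ-w± n ⟩
  1ℤ * (+ n * θ n)
    ≡⟨ ℤP.*-identityˡ (+ n * θ n) ⟩
  + n * θ n ∎)
  where open ≡-Reasoning

D-one : ∀ n → D one n ≡ 0ℤ
D-one zero    = refl
D-one (suc n) = ℤP.*-zeroʳ (+ suc n)

conv-swap : ∀ n (f g h : ℕ → ℤ) → conv (conv f g) h n ≡ conv f (conv h g) n
conv-swap n f g h = trans (conv-assoc n f g h) (conv-congˡ n f (λ m → conv-comm m g h))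

Dθ^ : ∀ k n → D (θ^ k) n ≡ + (2 ℕ.* k) * conv (θ^ k) σ± n
Dθ^ zero    n = D-one n
Dθ^ (suc k) n = begin
  D (conv θ (θ^ k)) n
    ≡⟨ D-conv n θ (θ^ k) ⟩
  conv (D θ) (θ^ k) n + conv θ (D (θ^ k)) n
    ≡⟨ cong₂ _+_
         (trans (conv-congʳ n (θ^ k) Dθ)
             (trans (conv-*ˡ n (+ 2) (conv θ σ±) (θ^ k)) (cong (+ 2 *_) (conv-swap n θ σ± (θ^ k)))))
         (trans (conv-congˡ n θ (Dθ^ k)) (conv-*ʳ n (+ (2 ℕ.* k)) θ (conv (θ^ k) σ±))) ⟩
  + 2 * conv θ (conv (θ^ k) σ±) n + + (2 ℕ.* k) * conv θ (conv (θ^ k) σ±) n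
    ≡⟨ ℤP.*-distribʳ-+ (conv θ (conv (θ^ k) σ±) n) (+ 2) (+ (2 ℕ.* k)) ⟨
  (+ 2 + + (2 ℕ.* k)) * conv θ (conv (θ^ k) σ±) n
    ≡⟨ cong₂ (λ c z → + c * z) (sym (ℕP.*-suc 2 k)) (sym (conv-assoc n θ (θ^ k) σ±)) ⟩
  + (2 ℕ.* suc k) * conv (θ^ (suc k)) σ± n ∎
  where open ≡-Reasoning

-- The coefficient of qⁿ in θ D g − k g D θ.
wronskian : ℕ → (ℕ → ℤ) → ℕ → ℤ
wronskian k g = diag (λ j m → (+ m - + k * + j) * (θ j * g m))

-- Both θ D θ^k and k θ^k D θ equal 2k θ θ^k σ±, by `Dθ^` and `Dθ`.
wronskian-θ^ : ∀ k n → wronskian k (θ^ k) n ≡ 0ℤ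
wronskian-θ^ k n = begin
  wronskian k (θ^ k) n
    ≡⟨ diag-cong n (λ j m _ → h (+ j) (+ m) (+ k) (θ j) (θ^ k m)) ⟩
  diag (λ j m → θ j * (+ m * θ^ k m) + (- + k) * (+ j * θ j * θ^ k m)) n
    ≡⟨ diag-+ n (λ j m → θ j * (+ m * θ^ k m)) (λ j m → (- + k) * (+ j * θ j * θ^ k m)) ⟩
  conv θ (D (θ^ k)) n + diag (λ j m → (- + k) * (+ j * θ j * θ^ k m)) n
    ≡⟨ cong₂ _+_ (trans (conv-congˡ n θ (Dθ^ k)) (conv-*ʳ n (+ (2 ℕ.* k)) θ (conv (θ^ k) σ±)))
         (trans (diag-*ˡ n (- + k) (λ j m → + j * θ j * θ^ k m)) (cong (λ z → - + k * z)
           (trans (conv-congʳ n (θ^ k) Dθ)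
               (trans (conv-*ˡ n (+ 2) (conv θ σ±) (θ^ k)) (cong (+ 2 *_) (conv-swap n θ σ± (θ^ k))))))) ⟩
  + (2 ℕ.* k) * conv θ (conv (θ^ k) σ±) n + - + k * (+ 2 * conv θ (conv (θ^ k) σ±) n)
    ≡⟨ cong (λ c → c * X + - + k * (+ 2 * X)) (ℤP.pos-* 2 k) ⟩
  + 2 * + k * X + - + k * (+ 2 * X)
    ≡⟨ l (+ k) X ⟩
  0ℤ ∎
  where
  open ≡-Reasoning
  X = conv θ (conv (θ^ k) σ±) n
  h : ∀ j m k x y → (m - k * j) * (x * y) ≡ x * (m * y) + (- k) * (j * x * y)
  h = solve-∀
  l : ∀ k x → + 2 * k * x + - k * (+ 2 * x) ≡ 0ℤ
  l = solve-∀

wronskian-linear : ∀ k n a c f g →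
    wronskian k (λ m → a * f m + c * g m) n ≡ a * wronskian k f n + c * wronskian k g n
wronskian-linear k n a c f g = trans
  (diag-cong n (λ j m _ → h (+ m - + k * + j) (θ j) a (f m) c (g m)))
  (trans (diag-+ n (λ j m → a * ((+ m - + k * + j) * (θ j * f m))) (λ j m → c * ((+ m - + k * + j) * (θ j * g m))))
    (cong₂ _+_ (diag-*ˡ n a (λ j m → (+ m - + k * + j) * (θ j * f m)))
        (diag-*ˡ n c (λ j m → (+ m - + k * + j) * (θ j * g m)))))
  where
  h : ∀ u x a y c z → u * (x * (a * y + c * z)) ≡ a * (u * (x * y)) + c * (u * (x * z))
  h = solve-∀

-- As θ 0 = 1, the coefficient at n > 0 contains E n with the factor n, and its other terms involve
-- only earlier values of E.
wronskian-zero : ∀ k (E : ℕ → ℤ) → E 0 ≡ 0ℤ → (∀ n → wronskian k E n ≡ 0ℤ) → ∀ n → E n ≡ 0ℤ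
wronskian-zero k E E0 h = <-rec (λ n → E n ≡ 0ℤ) go
  where
  go : ∀ n → (∀ {m} → m ℕ.< n → E m ≡ 0ℤ) → E n ≡ 0ℤ
  go zero    _  = E0
  go (suc n) ih = ℤP.*-cancelˡ-≡ (+ suc n) (E (suc n)) 0ℤ (begin
    + suc n * E (suc n)
      ≡⟨ l (+ suc n) (+ k) (E (suc n)) ⟩
    (+ suc n - + k * 0ℤ) * (1ℤ * E (suc n))
      ≡⟨ diag-point (suc n) 0 (suc n) (λ j m → (+ m - + k * + j) * (θ j * E m)) refl off ⟨
    wronskian k E (suc n)
      ≡⟨ h (suc n) ⟩
    0ℤ
      ≡⟨ ℤP.*-zeroʳ (+ suc n) ⟨
    + suc n * 0ℤ ∎)
    where
    open ≡-Reasoning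
    l : ∀ n k x → n * x ≡ (n - k * 0ℤ) * (1ℤ * x)
    l = solve-∀
    off : ∀ j m → j ℕ.+ m ≡ suc n → j ≢ 0 → (+ m - + k * + j) * (θ j * E m) ≡ 0ℤ
    off zero    m e j≢0 = ⊥-elim (j≢0 refl)
    off (suc j) m e _   =
        trans (cong (λ z → (+ m - + k * + suc j) * (θ (suc j) * z))
        (ih (ℕP.≤-trans (ℕP.m≤n+m (suc m) j) (ℕP.≤-reflexive (trans (ℕP.+-suc j m) e)))))
      (z (+ m - + k * + suc j) (θ (suc j)))
      where
      z : ∀ a x → a * (x * 0ℤ) ≡ 0ℤ
      z = solve-∀

θ^-0 : ∀ k → θ^ k 0 ≡ 1ℤ
θ^-0 zero    = refl
θ^-0 (suc k) = trans (ℤP.*-identityˡ (θ^ k 0)) (θ^-0 k)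

θ^-unique : ∀ k c (g : ℕ → ℤ) → g 0 ≡ c → (∀ n → wronskian k g n ≡ 0ℤ) → ∀ n → g n ≡ c * θ^ k n
θ^-unique k c g g0 h n = begin
  g n                                       ≡⟨ l (g n) c (θ^ k n) ⟩
  (1ℤ * g n + (- c) * θ^ k n) + c * θ^ k n  ≡⟨ cong (_+ c * θ^ k n) (wronskian-zero k E E0 hE n) ⟩
  0ℤ + c * θ^ k n                           ≡⟨ ℤP.+-identityˡ _ ⟩
  c * θ^ k n                                ∎
  where
  open ≡-Reasoning
  E : ℕ → ℤ
  E m = 1ℤ * g m + (- c) * θ^ k m
  l : ∀ x c y → x ≡ (1ℤ * x + (- c) * y) + c * y
  l = solve-∀
  E0 : E 0 ≡ 0ℤ
  E0 = trans (cong₂ (λ x y → 1ℤ * x + - c * y) g0 (θ^-0 k)) (z c)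
    where
    z : ∀ c → 1ℤ * c + - c * 1ℤ ≡ 0ℤ
    z = solve-∀
  hE : ∀ n → wronskian k E n ≡ 0ℤ
  hE n = trans (wronskian-linear k n 1ℤ (- c) g (θ^ k))
      (trans (cong₂ (λ x y → 1ℤ * x + - c * y) (h n) (wronskian-θ^ k n)) (z c))
    where
    z : ∀ c → 1ℤ * 0ℤ + - c * 0ℤ ≡ 0ℤ
    z = solve-∀

wronskian-one : ∀ k n → wronskian k one n ≡ - (+ k * (+ n * θ n))
wronskian-one k n = trans
  (diag-point n n 0 (λ j m → (+ m - + k * + j) * (θ j * one m)) (ℕP.+-identityʳ n) off) (h (+ k) (+ n) (θ n))
  where
  h : ∀ k n x → (0ℤ - k * n) * (x * 1ℤ) ≡ - (k * (n * x))
  h = solve-∀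
  off : ∀ j m → j ℕ.+ m ≡ n → j ≢ n → (+ m - + k * + j) * (θ j * one m) ≡ 0ℤ
  off j zero    e j≢n = ⊥-elim (j≢n (trans (sym (ℕP.+-identityʳ j)) e))
  off j (suc m) e _   = z (+ suc m - + k * + j) (θ j)
    where
    z : ∀ a x → a * (x * 0ℤ) ≡ 0ℤ
    z = solve-∀

divisorSum-0 : ∀ w → divisorSum w 0 ≡ 0ℤ
divisorSum-0 w = trans (Σ-cong (Δ 0) (λ {δ} m → ⊥-elim (empty δ (∈-Δ⁻ m)))) (Σ-0 (Δ 0))
  where
  empty : ∀ δ → ¬ InD 0 δ
  empty (+ suc d , + suc e) (inD () (+<+ _) (+<+ _))

wronskian-divisorSum : ∀ k n w →
    wronskian k (divisorSum w) n ≡ Σ[ Ω n ] (λ (i , d , e) → (d * e - + k * (i * i)) * w d e)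
wronskian-divisorSum k n w = diag-θ-divisorSum n (λ x y → y - + k * x) w

-- The constant term a contributes -k a n θ(n) to the Wronskian and the divisor sum contributes half
-- of c c′ n θ(n); the first hypothesis says that they cancel.
θ^-divisorSum : ∀ k a c c′ w → + 2 * + k * a ≡ c * c′ →
  (∀ n → + 2 * (Σ[ Ω n ] (λ (i , d , e) → (d * e - + k * (i * i)) * w d e)) ≡ c′ * (+ n * θ n)) →
  ∀ n → a * one n + c * divisorSum w n ≡ a * θ^ k n
θ^-divisorSum k a c c′ w hc hw = θ^-unique k a (λ n → a * one n + c * divisorSum w n)
  (trans (cong (λ z → a * 1ℤ + c * z) (divisorSum-0 w)) (h a c)) λ n →
  trans (wronskian-linear k n a c one (divisorSum w))
      (trans (cong₂ (λ x y → a * x + c * y) (wronskian-one k n) (wronskian-divisorSum k n w))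
    (ℤP.*-cancelˡ-≡ (+ 2) _ 0ℤ
        (cancel (+ k) a c (+ n * θ n) (Σ[ Ω n ] (λ (i , d , e) → (d * e - + k * (i * i)) * w d e)) c′ hc (hw n))))
  where
  h : ∀ a c → a * 1ℤ + c * 0ℤ ≡ a
  h = solve-∀
  cancel : ∀ k a c x y c′ → + 2 * k * a ≡ c * c′ → + 2 * y ≡ c′ * x → + 2 * (a * - (k * x) + c * y) ≡ 0ℤ
  cancel k a c x y c′ p q = trans (h₁ k a c x y) (trans (cong₂ (λ u v → - (u * x) + c * v) p q) (h₂ c c′ x))
    where
    h₁ : ∀ k a c x y → + 2 * (a * - (k * x) + c * y) ≡ - (+ 2 * k * a * x) + c * (+ 2 * y)
    h₁ = solve-∀
    h₂ : ∀ c c′ x → - (c * c′ * x) + c * (c′ * x) ≡ 0ℤ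
    h₂ = solve-∀

θ^4 : ∀ n → 1ℤ * one n + + 8 * divisorSum w₄ n ≡ 1ℤ * θ^ 4 n
θ^4 = θ^-divisorSum 4 1ℤ (+ 8) 1ℤ w₄ refl Σ-w₄

-- The 7 clears the denominator of 8 + ... + 8^a = (8^(a+1) - 8) / 7. This sum occurs in 16 Σ
-- (-1)^(n+d) d³ over the divisors d of n = 2^a m, m odd; subtracting 1 gives (8 · 8^a - 15) / 7,
-- the origin of 8 and 15 in `w₈`.
θ^8 : ∀ n → + 7 * one n + + 16 * divisorSum w₈ n ≡ + 7 * θ^ 8 n
θ^8 = θ^-divisorSum 8 (+ 7) (+ 16) (+ 7) w₈ refl Σ-w₈

-- The function σ*

parity-*-Δ : ∀ {n d e} → InD n (d , e) → par d ℙ.* par e ≡ parity n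
parity-*-Δ {n} {d} {e} (inD q _ _) =
    trans (sym (ℙP.*-homo-* ∣ d ∣ ∣ e ∣)) (cong parity (trans (sym (ℤP.abs-* d e)) (cong ∣_∣ q)))

odd-% : ∀ n → parity n ≡ 1ℙ → n % 2 ≡ 1
odd-% (suc zero)    _ = refl
odd-% (suc (suc n)) h = odd-% n h

%2≡ᵇ1⇒odd : ∀ n → T (n % 2 ≡ᵇ 1) → parity n ≡ 1ℙ
%2≡ᵇ1⇒odd (suc zero)    _ = refl
%2≡ᵇ1⇒odd (suc (suc n)) h = %2≡ᵇ1⇒odd n h

oddQuot⁻ : ∀ q i → T (oddQuot q (suc i)) → suc i ∣ q × parity (q / suc i) ≡ 1ℙ
oddQuot⁻ q i h with suc i ∣? q
... | yes d = d , %2≡ᵇ1⇒odd (q / suc i) h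

oddQuot⁺ : ∀ q i → suc i ∣ q → parity (q / suc i) ≡ 1ℙ → T (oddQuot q (suc i))
oddQuot⁺ q i d odd with suc i ∣? q
... | yes _ = subst (λ m → T (m ≡ᵇ 1)) (sym (odd-% (q / suc i) odd)) tt
... | no ¬d = ¬d d

wσ : ℤ → ℤ → ℤ
wσ d e = byParity (par d) (par e) d d 0ℤ

odd-e? : Decidable (λ (δ : ℤ × ℤ) → par (proj₂ δ) ≡ 1ℙ)
odd-e? δ = par (proj₂ δ) ℙP.≟ 1ℙ

Δᵒ : ℕ → List (ℤ × ℤ)
Δᵒ n = filter odd-e? (Δ n)

Δᵒ-unique : ∀ n → Unique (Δᵒ n)
Δᵒ-unique n = Uniq.filter⁺ odd-e? (Δ-unique n)

∈-Δᵒ⁺ : ∀ {n δ} → InD n δ → par (proj₂ δ) ≡ 1ℙ → δ ∈ Δᵒ n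
∈-Δᵒ⁺ h odd = ∈-filter⁺ odd-e? (∈-Δ⁺ h) odd

∈-Δᵒ⁻ : ∀ {n δ} → δ ∈ Δᵒ n → InD n δ × par (proj₂ δ) ≡ 1ℙ
∈-Δᵒ⁻ {n} m with m′ , odd ← ∈-filter⁻ odd-e? {xs = Δ n} m = ∈-Δ⁻ m′ , odd

σ-sum-Δᵒ : ∀ n → divisorSum wσ n ≡ Σ[ Δᵒ n ] proj₁
σ-sum-Δᵒ n = begin
  divisorSum wσ n
    ≡⟨ Σ-split odd-e? (Δ n) (λ (d , e) → wσ d e) ⟩
  (Σ[ Δᵒ n ] (λ (d , e) → wσ d e)) + (Σ[ filter (¬? ∘ odd-e?) (Δ n) ] (λ (d , e) → wσ d e))
    ≡⟨ cong₂ _+_ (Σ-cong (Δᵒ n) (λ {(d , e)} m → on (par d) (proj₂ (∈-Δᵒ⁻ m))))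
         (trans (Σ-cong (filter (¬? ∘ odd-e?) (Δ n)) (λ {(d , e)} m →
             off (par d) (proj₂ (∈-filter⁻ (¬? ∘ odd-e?) {xs = Δ n} m)))) (Σ-0 (filter (¬? ∘ odd-e?) (Δ n)))) ⟩
  (Σ[ Δᵒ n ] proj₁) + 0ℤ
    ≡⟨ ℤP.+-identityʳ _ ⟩
  Σ[ Δᵒ n ] proj₁ ∎
  where
  open ≡-Reasoning
  on : ∀ p {q x} → q ≡ 1ℙ → byParity p q x x 0ℤ ≡ x
  on 0ℙ refl = refl
  on 1ℙ refl = refl
  off : ∀ p {q x} → q ≢ 1ℙ → byParity p q x x 0ℤ ≡ 0ℤ
  off 0ℙ {0ℙ} _ = refl
  off 1ℙ {0ℙ} _ = refl
  off _  {1ℙ} h = ⊥-elim (h refl)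

+foldr : ∀ xs → + foldr ℕ._+_ 0 xs ≡ Σ[ xs ] (λ d → + d)
+foldr []       = refl
+foldr (x ∷ xs) = cong (λ z → + x + z) (+foldr xs)

σ*ℕ≡σ-sum : ∀ n → + σ*ℕ (suc n) ≡ divisorSum wσ (suc n)
σ*ℕ≡σ-sum n = trans (+foldr divisors) (trans
  (Σ-bij (Uniq.filter⁺ P? (Uniq.map⁺ ℕP.suc-injective (Uniq.upTo⁺ q))) (Δᵒ-unique q) pair (λ δ → ∣ proj₁ δ ∣) to
      from)
  (sym (σ-sum-Δᵒ q)))
  where
  q = suc n
  P? : Decidable (λ d → T (oddQuot q d))
  P? d = T? (oddQuot q d)
  divisors = filter P? (map suc (upTo q))
  pair : ℕ → ℤ × ℤ
  pair zero    = 0ℤ , 0ℤ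
  pair (suc i) = + suc i , + (q / suc i)
  to : ∀ {d} → d ∈ divisors → pair d ∈ Δᵒ q × ∣ proj₁ (pair d) ∣ ≡ d × + d ≡ proj₁ (pair d)
  to {d} m with ∈-filter⁻ P? {xs = map suc (upTo q)} m
  ... | m′ , h with ∈-map⁻ suc m′
  ... | i , _ , refl with d∣q , odd ← oddQuot⁻ q i h =
      ∈-Δᵒ⁺ (inD prod (+<+ (s≤s z≤n)) (positive (q / suc i) odd)) odd , refl , refl
    where
    prod : + suc i * + (q / suc i) ≡ + q
    prod = trans (sym (ℤP.pos-* (suc i) (q / suc i))) (cong +_ (m*[n/m]≡n d∣q))
    positive : ∀ k → parity k ≡ 1ℙ → 0ℤ < + k
    positive (suc k) _ = +<+ (s≤s z≤n)
  from : ∀ {δ} → δ ∈ Δᵒ q → ∣ proj₁ δ ∣ ∈ divisors × pair ∣ proj₁ δ ∣ ≡ δ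
  from {δ} m with ∈-Δᵒ⁻ m
  from {+ suc i , + suc j} m | inD prod (+<+ _) (+<+ _) , odd =
      ∈-filter⁺ P? (∈-map⁺ suc (∈-upTo⁺ (∣⇒≤ d∣q))) (oddQuot⁺ q i d∣q (trans (cong parity quot) odd))
    , cong (λ k → + suc i , + k) quot
    where
    q≡ : q ≡ suc j ℕ.* suc i
    q≡ = trans (sym (ℤP.+-injective prod)) (ℕP.*-comm (suc i) (suc j))
    d∣q : suc i ∣ q
    d∣q = divides (suc j) q≡
    quot : q / suc i ≡ suc j
    quot = trans (cong (_/ suc i) q≡) (m*n/n≡m (suc j) (suc i))

-- If d e = 2n with e odd, then d is even, so halving d inverts doubling it.
σ-sum-double : ∀ n → divisorSum wσ (n ℕ.+ n) ≡ + 2 * divisorSum wσ n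
σ-sum-double n = trans (σ-sum-Δᵒ (n ℕ.+ n)) (trans (sym (Σ-bij (Δᵒ-unique n) (Δᵒ-unique (n ℕ.+ n))
    (λ (d , e) → d + d , e) (λ (d , e) → + ⌊ ∣ d ∣ /2⌋ , e) to from))
  (trans (Σ-*ˡ (Δᵒ n) (+ 2) proj₁) (cong (+ 2 *_) (sym (σ-sum-Δᵒ n)))))
  where
  to : ∀ {δ} → δ ∈ Δᵒ n → (proj₁ δ + proj₁ δ , proj₂ δ) ∈ Δᵒ (n ℕ.+ n) ×
    (+ ⌊ ∣ proj₁ δ + proj₁ δ ∣ /2⌋ , proj₂ δ) ≡ δ × + 2 * proj₁ δ ≡ proj₁ δ + proj₁ δ
  to {d , e} m with inD prod d>0 e>0 , odd ← ∈-Δᵒ⁻ m =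
      ∈-Δᵒ⁺ (inD (trans (ℤP.*-distribʳ-+ e d d) (cong₂ _+_ prod prod)) (ℤP.+-mono-< d>0 d>0) e>0) odd
    , cong (_, e) (trans (cong (λ z → + ⌊ ∣ z + z ∣ /2⌋) (0<⇒+ d>0))
        (trans (cong +_ (sym (ℕP.n≡⌊n+n/2⌋ ∣ d ∣))) (sym (0<⇒+ d>0))))
    , two d
    where
    two : ∀ d → + 2 * d ≡ d + d
    two = solve-∀
  from : ∀ {δ} → δ ∈ Δᵒ (n ℕ.+ n) → (+ ⌊ ∣ proj₁ δ ∣ /2⌋ , proj₂ δ) ∈ Δᵒ n ×
    (+ ⌊ ∣ proj₁ δ ∣ /2⌋ + + ⌊ ∣ proj₁ δ ∣ /2⌋ , proj₂ δ) ≡ δ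
  from {d , e} m with h@(inD prod d>0 e>0) , odd ← ∈-Δᵒ⁻ m =
      ∈-Δᵒ⁺ (inD (double-injective (trans (sym (ℤP.*-distribʳ-+ e k k)) (trans (cong (_* e) (sym d≡)) prod)))
          (0<half (subst (0ℤ <_) d≡ d>0)) e>0) odd
    , cong (_, e) (sym d≡)
    where
    k = + ⌊ ∣ d ∣ /2⌋
    even : par d ≡ 0ℙ
    even = trans (sym (ℙP.*-identityʳ (par d)))
        (trans (cong (par d ℙ.*_) (sym odd)) (trans (parity-*-Δ h) (parity-double n)))
    d≡ : d ≡ k + k
    d≡ = trans (0<⇒+ d>0) (cong +_ (even⇒double ∣ d ∣ even))

σ±-odd : ∀ n → parity n ≡ 1ℙ → σ± n ≡ divisorSum wσ n
σ±-odd n odd = Σ-cong (Δ n) (λ {(d , e)} m → go (par d) (par e) (trans (parity-*-Δ (∈-Δ⁻ m)) odd))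
  where
  go : ∀ p q {d} → p ℙ.* q ≡ 1ℙ → byParity p q d (- d) 0ℤ ≡ byParity p q d d 0ℤ
  go 1ℙ 1ℙ _ = refl

σ±-even : ∀ n → parity n ≡ 0ℙ → σ± n ≡ (- + 1) * divisorSum wσ n
σ±-even n even = trans (Σ-cong (Δ n) (λ {(d , e)} m → go (par d) (par e) d (trans (parity-*-Δ (∈-Δ⁻ m)) even)))
    (Σ-*ˡ (Δ n) (- + 1) (λ (d , e) → wσ d e))
  where
  go : ∀ p q d → p ℙ.* q ≡ 0ℙ → byParity p q d (- d) 0ℤ ≡ (- + 1) * byParity p q d d 0ℤ
  go 0ℙ 0ℙ d _ = refl
  go 0ℙ 1ℙ d _ = sym (ℤP.-1*i≡-i d)
  go 1ℙ 0ℙ d _ = refl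

σ*-integer : ∀ q {m} → ↥ q ≡ + suc m → ↧ q ≡ 1ℤ → σ* q ≡ σ*ℕ (suc m)
σ*-integer (mkℚ (+ suc m) zero _) refl refl = refl

σ*-/1 : ∀ m → σ* (+ suc m ℚ./ 1) ≡ σ*ℕ (suc m)
σ*-/1 m rewrite ℚP.normalize-coprime (Coprime.sym (Coprime.1-coprimeTo (suc m))) = refl

-- The fraction is not in lowest terms; its numerator and denominator are recovered from their
-- products with the gcd, which is 2.
σ*-even/2 : ∀ m → σ* (+ (suc m ℕ.+ suc m) ℚ./ 2) ≡ σ*ℕ (suc m)
σ*-even/2 m = σ*-integer q
  (ℤP.*-cancelʳ-≡ (↥ q) (+ suc m) (+ 2)
      (trans (cong (λ g → ↥ q * + g) (sym gcd≡2)) (trans (ℚP.↥-normalize n 2) (two (+ suc m)))))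
  (ℤP.*-cancelʳ-≡ (↧ q) 1ℤ (+ 2) (trans (cong (λ g → ↧ q * + g) (sym gcd≡2)) (ℚP.↧-normalize n 2)))
  where
  n = suc m ℕ.+ suc m
  q = + n ℚ./ 2
  two : ∀ x → x + x ≡ x * + 2
  two = solve-∀
  gcd≡2 : gcd n 2 ≡ 2
  gcd≡2 = ∣-antisym (gcd[m,n]∣n n 2)
      (gcd-greatest (divides (suc m) (ℤP.+-injective (trans (two (+ suc m)) (sym (ℤP.pos-* (suc m) 2))))) ∣-refl)

2∤odd : ∀ {n} → parity n ≡ 1ℙ → ¬ 2 ∣ n
2∤odd odd (divides k refl) with trans (sym odd) (trans (ℙP.*-homo-* k 2) (ℙP.*-zeroʳ (parity k)))
... | ()

odd⇒coprime-2 : ∀ {n} → parity n ≡ 1ℙ → Coprime n 2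
odd⇒coprime-2 odd (d∣n , d∣2) with prime⇒irreducible prime[2] d∣2
... | inj₁ d≡1  = d≡1
... | inj₂ refl = ⊥-elim (2∤odd odd d∣n)

σ*-odd/2 : ∀ m → parity m ≡ 1ℙ → σ* (+ m ℚ./ 2) ≡ 0
σ*-odd/2 m odd rewrite ℚP.normalize-coprime {m} {1} (odd⇒coprime-2 odd) = refl

-- For an odd argument the half is not an integer and contributes 0. Otherwise σ*(2k) - 4 σ*(k) = -2
-- σ*(k) = -σ*(2k), which is the sign of `w±` on (even, odd).
σ*-difference : ∀ m → + σ* (+ suc m ℚ./ 1) - + 4 * + σ* (+ suc m ℚ./ 2) ≡ σ± (suc m)
σ*-difference m with parity (suc m) in eq
... | 1ℙ = begin
  + σ* (+ suc m ℚ./ 1) - + 4 * + σ* (+ suc m ℚ./ 2)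
    ≡⟨ cong₂ (λ x y → + x - + 4 * + y) (σ*-/1 m) (σ*-odd/2 (suc m) eq) ⟩
  + σ*ℕ (suc m) - + 4 * 0ℤ
    ≡⟨ ℤP.+-identityʳ _ ⟩
  + σ*ℕ (suc m)
    ≡⟨ trans (σ*ℕ≡σ-sum m) (sym (σ±-odd (suc m) eq)) ⟩
  σ± (suc m) ∎
  where open ≡-Reasoning
... | 0ℙ with ⌊ suc m /2⌋ | even⇒double (suc m) eq
... | suc k | m≡ = begin
  + σ* (+ suc m ℚ./ 1) - + 4 * + σ* (+ suc m ℚ./ 2)
    ≡⟨ cong₂ (λ x y → + x - + 4 * + y) (σ*-/1 m) (trans (cong (λ n → σ* (+ n ℚ./ 2)) m≡) (σ*-even/2 k)) ⟩
  + σ*ℕ (suc m) - + 4 * + σ*ℕ (suc k)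
    ≡⟨ cong₂ (λ x y → x - + 4 * y) (trans (σ*ℕ≡σ-sum m) (trans (cong (divisorSum wσ) m≡) (σ-sum-double (suc k))))
        (σ*ℕ≡σ-sum k) ⟩
  + 2 * divisorSum wσ (suc k) - + 4 * divisorSum wσ (suc k)
    ≡⟨ h (divisorSum wσ (suc k)) ⟩
  (- + 1) * (+ 2 * divisorSum wσ (suc k))
    ≡⟨ cong (λ z → (- + 1) * z) (trans (sym (σ-sum-double (suc k))) (cong (divisorSum wσ) (sym m≡))) ⟩
  (- + 1) * divisorSum wσ (suc m)
    ≡⟨ σ±-even (suc m) eq ⟨
  σ± (suc m) ∎
  where
  open ≡-Reasoning
  h : ∀ x → + 2 * x - + 4 * x ≡ (- + 1) * (+ 2 * x)
  h = solve-∀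

-- Evaluation at a prime

-- The full convolution has two more terms than S: the one at j = 0 is σ±(suc p), and the one at j =
-- suc p vanishes because σ± 0 = 0.
S≡conv : ∀ k p → S k (suc p) ≡ conv (θ^ k) σ± (suc p) - σ± (suc p)
S≡conv k p = begin
  S k (suc p)
    ≡⟨ Σ-cong (upTo p) (λ {i} m → cong₂ _*_ (r≡θ^ k (suc i)) (weight i (∈-upTo⁻ m))) ⟩
  Σ[ upTo p ] term
    ≡⟨ cancel (σ± (suc p)) (Σ[ upTo p ] term) (θ^ k (suc p)) ⟩
  (1ℤ * σ± (suc p) + ((Σ[ upTo p ] term) + θ^ k (suc p) * 0ℤ)) - σ± (suc p)
    ≡⟨ cong₂ (λ x y → (x * σ± (suc p) + ((Σ[ upTo p ] term) + θ^ k (suc p) * y)) - σ± (suc p)) (sym (θ^-0 k))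
        (sym (trans (cong σ± (ℕP.n∸n≡0 p)) (divisorSum-0 w±))) ⟩
  (θ^ k 0 * σ± (suc p) + ((Σ[ upTo p ] term) + term p)) - σ± (suc p)
    ≡⟨ cong (λ z → (θ^ k 0 * σ± (suc p) + z) - σ± (suc p)) (Σ-upTo-suc p term) ⟨
  (θ^ k 0 * σ± (suc p) + (Σ[ upTo (suc p) ] term)) - σ± (suc p)
    ≡⟨ cong (λ z → (θ^ k 0 * σ± (suc p) + z) - σ± (suc p)) (diag-upTo p (θ^ k ∘ suc) σ±) ⟨
  conv (θ^ k) σ± (suc p) - σ± (suc p) ∎
  where
  open ≡-Reasoning
  term : ℕ → ℤ
  term i = θ^ k (suc i) * σ± (p ℕ.∸ i)
  cancel : ∀ f s x → s ≡ (1ℤ * f + (s + x * 0ℤ)) - f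
  cancel = solve-∀
  weight : ∀ i → i ℕ.< p → + σ* (diffℚ (suc p) (suc i)) - + 4 * + σ* (halfDiffℚ (suc p) (suc i)) ≡ σ± (p ℕ.∸ i)
  weight i i<p with p ℕ.∸ i | ℤP.⊖-≥ (ℕP.<⇒≤ i<p) | ℕP.m<n⇒0<n∸m i<p
  ... | suc m | e | _ rewrite trans (ℤP.[1+m]⊖[1+n]≡m⊖n p i) e = σ*-difference m

odd-prime : ∀ {p} → Prime p → p ≢ 2 → parity p ≡ 1ℙ
odd-prime {p} pr p≢2 with parity p in eq
... | 1ℙ = refl
... | 0ℙ with prime⇒irreducible pr (divides ⌊ p /2⌋ (trans (even⇒double p eq) (two ⌊ p /2⌋)))
  where
  two : ∀ k → k ℕ.+ k ≡ k ℕ.* 2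
  two k = trans (cong (k ℕ.+_) (sym (ℕP.+-identityʳ k))) (ℕP.*-comm 2 k)
... | inj₁ ()
... | inj₂ 2≡p = ⊥-elim (p≢2 (sym 2≡p))

divisorSum-prime : ∀ w {p} → Prime p → divisorSum w p ≡ w 1ℤ (+ p) + w (+ p) 1ℤ
divisorSum-prime w {p} pr = trans (Σ-bij {ys = (1ℤ , + p) ∷ (+ p , 1ℤ) ∷ []} {g = λ (d , e) → w d e} (Δ-unique p)
    (((λ h → p≢1 (sym (ℤP.+-injective (cong proj₁ h)))) ∷ []) ∷ [] ∷ []) (λ δ → δ) (λ δ → δ)
    (λ m → to (∈-Δ⁻ m) , refl , refl) (λ m → ∈-Δ⁺ (from m) , refl))
  (cong (λ z → w 1ℤ (+ p) + z) (ℤP.+-identityʳ (w (+ p) 1ℤ)))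
  where
  p≢1 : p ≢ 1
  p≢1 refl = ℕP.<-irrefl refl (ℕ.nonTrivial⇒n>1 1 {{prime⇒nonTrivial pr}})
  p>0 : 0ℤ < + p
  p>0 = +<+ (ℕ.>-nonZero⁻¹ p {{prime⇒nonZero pr}})
  to : ∀ {δ} → InD p δ → δ ∈ (1ℤ , + p) ∷ (+ p , 1ℤ) ∷ []
  to {+ suc d , + suc e} (inD prod (+<+ _) (+<+ _)) with ℤP.+-injective prod
  ... | de≡p with prime⇒irreducible pr (divides (suc e) (trans (sym de≡p) (ℕP.*-comm (suc d) (suc e))))
  ... | inj₁ refl = here (cong (λ k → 1ℤ , + k) (trans (sym (ℕP.+-identityʳ (suc e))) de≡p))
  ... | inj₂ refl = there
      (here (cong (λ k → + suc d , + k)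
      (ℕP.*-cancelˡ-≡ (suc e) 1 (suc d) (trans de≡p (sym (ℕP.*-identityʳ (suc d)))))))
  from : ∀ {δ} → δ ∈ (1ℤ , + p) ∷ (+ p , 1ℤ) ∷ [] → InD p δ
  from (here refl)         = inD (ℤP.*-identityˡ (+ p)) (+<+ (s≤s z≤n)) p>0
  from (there (here refl)) = inD (ℤP.*-identityʳ (+ p)) p>0 (+<+ (s≤s z≤n))

module _ {p : ℕ} (pr : Prime p) (odd : parity p ≡ 1ℙ) where

  -- Both factorizations of an odd prime lie in the class (odd, odd).
  divisorSum-odd-prime : ∀ (f g : ℤ → ℤ → ℤ) →
      divisorSum (λ d e → byParity (par d) (par e) (f d e) (g d e) 0ℤ) p ≡ f 1ℤ (+ p) + f (+ p) 1ℤ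
  divisorSum-odd-prime f g =
      trans (divisorSum-prime _ pr)
      (cong₂ (λ q q′ → byParity 1ℙ q (f 1ℤ (+ p)) (g 1ℤ (+ p)) 0ℤ + byParity q′ 1ℙ (f (+ p) 1ℤ) (g (+ p) 1ℤ) 0ℤ) odd
      odd)

  σ±-prime : σ± p ≡ 1ℤ + + p
  σ±-prime = divisorSum-odd-prime (λ d e → d) (λ d e → - d)

  one-prime : one p ≡ 0ℤ
  one-prime = h p odd
    where
    h : ∀ n → parity n ≡ 1ℙ → one n ≡ 0ℤ
    h (suc n) _ = refl

  θ^4-prime : θ^ 4 p ≡ + 8 * (1ℤ + + p)
  θ^4-prime = begin
    θ^ 4 p                     ≡⟨ ℤP.*-identityˡ (θ^ 4 p) ⟨
    1ℤ * θ^ 4 p                ≡⟨ θ^4 p ⟨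
    1ℤ * one p + + 8 * divisorSum w₄ p  ≡⟨ cong₂ (λ x y → 1ℤ * x + + 8 * y) one-prime
        (divisorSum-odd-prime (λ d e → d) (λ d e → + 3 * e)) ⟩
    0ℤ + + 8 * (1ℤ + + p)      ≡⟨ ℤP.+-identityˡ _ ⟩
    + 8 * (1ℤ + + p)           ∎
    where open ≡-Reasoning

  θ^8-prime : θ^ 8 p ≡ + 16 * (1ℤ + + p * + p * + p)
  θ^8-prime = ℤP.*-cancelˡ-≡ (+ 7) (θ^ 8 p) _ (begin
    + 7 * θ^ 8 p                 ≡⟨ θ^8 p ⟨
    + 7 * one p + + 16 * divisorSum w₈ p  ≡⟨ cong₂ (λ x y → + 7 * x + + 16 * y) one-prime
                                      (divisorSum-odd-prime (λ d e → + 7 * (d * d * d)) (λ d e →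
                                          + 8 * (d * d * d) - + 15 * (e * e * e))) ⟩
    0ℤ + + 16 * (+ 7 + + 7 * (+ p * + p * + p))  ≡⟨ h (+ p) ⟩
    + 7 * (+ 16 * (1ℤ + + p * + p * + p)) ∎)
    where
    open ≡-Reasoning
    h : ∀ p → 0ℤ + + 16 * (+ 7 + + 7 * (p * p * p)) ≡ + 7 * (+ 16 * (1ℤ + p * p * p))
    h = solve-∀

theorem3p5 : (p : ℕ) → Prime p → p ≢ 2 →
    (S 4 p ≡ (+ p) ^ 2 - + 1) × (S 8 p ≡ (+ p) ^ 4 - + 1)
theorem3p5 zero      pr p≢2 with () ← odd-prime pr p≢2
theorem3p5 p@(suc n) pr p≢2 =
    evaluate 4 (+ p * (1ℤ + + p)) (trans (cong (+ p *_) (θ^4-prime pr odd)) (h₄ (+ p))) (k₄ (+ p))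
  , evaluate 8 (+ p * (1ℤ + + p * + p * + p)) (trans (cong (+ p *_) (θ^8-prime pr odd)) (h₈ (+ p))) (k₈ (+ p))
  where
  odd : parity p ≡ 1ℙ
  odd = odd-prime pr p≢2
  -- X is the coefficient of θ^k σ± at p, which `Dθ^` gives as p r_k(p) / (2k): p (1 + p) for k = 4
  -- and p (1 + p³) for k = 8. Subtracting the term σ±(p) = 1 + p at j = 0 leaves p² - 1 and p⁴ - 1.
  evaluate : ∀ k .{{_ : ℕ.NonZero k}} X {s} → + p * θ^ k p ≡ + (2 ℕ.* k) * X → X - (1ℤ + + p) ≡ s → S k p ≡ s
  evaluate k@(suc _) X h e = trans (S≡conv k n) (trans
    (cong₂ _-_ (ℤP.*-cancelˡ-≡ (+ (2 ℕ.* k)) (conv (θ^ k) σ± p) X (trans (sym (Dθ^ k p)) h)) (σ±-prime pr odd)) e)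
  h₄ : ∀ p → p * (+ 8 * (1ℤ + p)) ≡ + 8 * (p * (1ℤ + p))
  h₄ = solve-∀
  h₈ : ∀ p → p * (+ 16 * (1ℤ + p * p * p)) ≡ + 16 * (p * (1ℤ + p * p * p))
  h₈ = solve-∀
  k₄ : ∀ p → p * (1ℤ + p) - (1ℤ + p) ≡ p * (p * 1ℤ) - 1ℤ
  k₄ = solve-∀
  k₈ : ∀ p → p * (1ℤ + p * p * p) - (1ℤ + p) ≡ p * (p * (p * (p * 1ℤ))) - 1ℤ
  k₈ = solve-∀
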